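{- Let $q$ be an odd prime power. Then the incidence structure $(\mathcal{L}_1,\mathcal{H}_1)$ is a generalized partial geometry of grade $3$, namely a $\mathrm{PG}(q-1,\,q(q^2-1)-1;\,q-2,q-1,q)$.
   Context: A line of $\mathrm{PG}(3,q)$ is represented by a $2\times4$ matrix of rank $2$ over $\mathbb{F}_q$ whose rows span it. Let $I_2$ be the $2\times 2$ identity matrix. Fix the line $(I_2\ \ 0)$. $\mathcal{L}_1$ is the set of all lines of $\mathrm{PG}(3,q)$ skew to $(I_2\ \ 0)$, i.e. $$\mathcal{L}_1=\{L_N=(N\ \ I_2): N\in\mathbb{F}_q^{2\times2}\}.$$ $\mathcal{H}_1$ is the set of all hyperbolic quadrics of $\mathrm{PG}(3,q)$ containing the line $(I_2\ \ 0)$; these are the quadrics with matrix $\begin{pmatrix} 0 & B \\ B^T & C \end{pmatrix}$, $B\in GL_2(\mathbb{F}_q)$, $C=C^T\in\mathbb{F}_q^{2\times2}$, where nonzero scalar multiples represent the same quadric. Viewed as a block, such a quadric is the set of lines of $\mathcal{L}_1$ contained in it: $$H_{B,C}=\Big\{L_N\in\mathcal{L}_1: L_N\begin{pmatrix} 0 & B \\ B^T & C \end{pmatrix}L_N^T=0\Big\}=\{L_N: B^TN^T+NB+C=0\}.$$ The "points" of the incidence structure $(\mathcal{L}_1,\mathcal{H}_1)$ are the lines in $\mathcal{L}_1$, the "blocks" are the elements of $\mathcal{H}_1$. A generalized partial geometry of grade $r$, denoted $\mathrm{PG}(s,t;\alpha_1,\dots,\alpha_r)$, is an incidence structure $(\mathcal{P},\mathcal{B})$,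 with $\mathcal{P}$ a finite non-empty set of points and $\mathcal{B}$ a family of subsets of $\mathcal{P}$ (blocks), incidence being containment, such that: (i) any two distinct points are incident with at most one common block; (ii) each block is incident with exactly $s+1$ points; (iii) each point is incident with exactly $t+1$ blocks; (iv) for any point $P$ and block $B$ with $P\notin B$, there is $\alpha\in\{\alpha_1,\dots,\alpha_r\}$ such that exactly $\alpha$ points of $B$ are joined to $P$ (two points are joined if some block contains both); (v) for each $\alpha\in\{\alpha_1,\dots,\alpha_r\}$ there exist a point $P$ and a block $B$ with $P\notin B$ such that exactly $\alpha$ points of $B$ are joined to $P$. -}

module Defs where

open import Algebra.Bundles using (CommutativeRing)
open import Data.Fin.Base using (Fin)
open import Data.Fin.Properties using (_≟_)
open import Data.Nat.Base as ℕ using (ℕ)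
open import Data.Nat.Primality using (Prime)
open import Data.Product.Base using (Σ; ∃; ∃₂; ∃-syntax; _×_; _,_; proj₁)
open import Data.Vec.Base as Vec using (Vec)
open import Data.Vec.Functional as Vector using (Vector; []; _∷_; _++_)
open import Function.Base using (_∘_)
open import Function.Bundles using (Inverse; _⇔_; mk⇔; Equivalence)
open import Level using (Level; _⊔_; suc)
open import Relation.Binary.Bundles using (Setoid)
import Relation.Binary.Construct.On as On
open import Relation.Binary.PropositionalEquality.Core using (_≡_)
import Relation.Binary.PropositionalEquality.Properties as ≡
open import Relation.Nullary.Decidable.Core using (does)
open import Relation.Nullary.Negation.Core using (¬_)
open import Data.Bool.Base using (if_then_else_)

private
  variable
    a ℓa b ℓb i p : Level

IsPrimePower : ℕ → Set
IsPrimePower q = ∃₂ λ p k → Prime p × 1 ℕ.≤ k × q ≡ p ℕ.^ k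

-- Elements of a setoid are counted up to its equality.
HasSize : Setoid a ℓa → ℕ → Set (a ⊔ ℓa)
HasSize S n = Inverse S (≡.setoid (Fin n))

SubsetOf : (S : Setoid a ℓa) → (Setoid.Carrier S → Set p) → Setoid (a ⊔ p) ℓa
SubsetOf S P = On.setoid S (proj₁ {B = P})

Exactly : ℕ → (S : Setoid a ℓa) → (Setoid.Carrier S → Set p) → Set (a ⊔ ℓa ⊔ p)
Exactly n S P = HasSize (SubsetOf S P) n

record IncidenceStructure a ℓa b ℓb i : Set (suc (a ⊔ ℓa ⊔ b ⊔ ℓb ⊔ i)) where
  infix 4 _∈_
  field
    Points : Setoid a ℓa
    Blocks : Setoid b ℓb

  open Setoid Points public using () renaming (Carrier to Point; _≈_ to _≈ₚ_)
  open Setoid Blocks public using () renaming (Carrier to Block; _≈_ to _≈ᵦ_)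

  field
    _∈_ : Point → Block → Set i

  Joined : Point → Point → Set (b ⊔ i)
  Joined P Q = ∃[ B ] (P ∈ B × Q ∈ B)

  JoinedPointsOf : Block → Point → ℕ → Set (a ⊔ ℓa ⊔ b ⊔ i)
  JoinedPointsOf B P n = Exactly n Points (λ Q → Q ∈ B × Joined P Q)

record IsGeneralizedPartialGeometry
  (𝓘 : IncidenceStructure a ℓa b ℓb i)
  (r s t : ℕ) (αs : Vec ℕ r) : Set (a ⊔ ℓa ⊔ b ⊔ ℓb ⊔ i) where
  open IncidenceStructure 𝓘
  field
    -- The blocks form a set of subsets of the point set: membership is
    -- well defined, and blocks are equal exactly when they have the same
    -- points.
    ∈-resp-≈ₚ      : ∀ {P Q} B → P ≈ₚ Q → P ∈ B → Q ∈ B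
    extensionality : ∀ B C → B ≈ᵦ C ⇔ (∀ P → P ∈ B ⇔ P ∈ C)

    finite    : ∃[ n ] HasSize Points n
    non-empty : Point

    common-block     : ∀ {P Q} → ¬ P ≈ₚ Q → ∀ {B C} →
                       P ∈ B → Q ∈ B → P ∈ C → Q ∈ C → B ≈ᵦ C
    points-per-block : ∀ B → Exactly (s ℕ.+ 1) Points (_∈ B)
    blocks-per-point : ∀ P → Exactly (t ℕ.+ 1) Blocks (P ∈_)
    joined           : ∀ P B → ¬ P ∈ B →
                       ∃[ j ] JoinedPointsOf B P (Vec.lookup αs j)
    attained         : ∀ j → ∃₂ λ P B →
                       ¬ P ∈ B × JoinedPointsOf B P (Vec.lookup αs j)

record FiniteField c ℓ (q : ℕ) : Set (suc (c ⊔ ℓ)) where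
  field
    commutativeRing : CommutativeRing c ℓ

  open CommutativeRing commutativeRing public

  field
    1≉0     : ¬ 1# ≈ 0#
    inverse : ∀ x → ¬ x ≈ 0# → ∃[ y ] x * y ≈ 1#
    size    : HasSize setoid q

module ProjectiveSpace {c ℓ q} (F : FiniteField c ℓ q) where
  open FiniteField F
  open import Algebra.Properties.Monoid.Sum +-monoid using (sum)
  open import Relation.Binary.Reasoning.Setoid setoid

  Matrix : ℕ → ℕ → Set c
  Matrix m n = Vector (Vector Carrier n) m

  infix 4 _≋_ _≈ₘ_
  _≋_ : ∀ {n} → Vector Carrier n → Vector Carrier n → Set ℓ
  u ≋ v = ∀ k → u k ≈ v k

  _≈ₘ_ : ∀ {m n} → Matrix m n → Matrix m n → Set ℓ
  A ≈ₘ B = ∀ k → A k ≋ B k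

  0ᵥ : ∀ {n} → Vector Carrier n
  0ᵥ _ = 0#

  0ₘ : ∀ {m n} → Matrix m n
  0ₘ _ = 0ᵥ

  I : ∀ n → Matrix n n
  I n j k = if does (j ≟ k) then 1# else 0#

  infixl 7 _·_ _∙_
  infix 8 _ᵀ
  _∙_ : ∀ {m n} → Vector Carrier m → Matrix m n → Vector Carrier n
  (v ∙ A) k = sum λ j → v j * A j k

  _·_ : ∀ {l m n} → Matrix l m → Matrix m n → Matrix l n
  (A · B) j = A j ∙ B

  _ᵀ : ∀ {m n} → Matrix m n → Matrix n m
  (A ᵀ) j k = A k j

  Invertible : ∀ {n} → Matrix n n → Set (c ⊔ ℓ)
  Invertible {n} A = ∃[ B ] (A · B ≈ₘ I n × B · A ≈ₘ I n)

  IndependentRows : ∀ {m n} → Matrix m n → Set (c ⊔ ℓ)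
  IndependentRows A = ∀ v → v ∙ A ≋ 0ᵥ → v ≋ 0ᵥ

  infix 4 _∈Span_
  _∈Span_ : ∀ {m n} → Vector Carrier n → Matrix m n → Set (c ⊔ ℓ)
  v ∈Span A = ∃[ u ] u ∙ A ≋ v

  record Line : Set (c ⊔ ℓ) where
    field
      matrix : Matrix 2 4
      rank-2 : IndependentRows matrix

  open Line public

  -- Two matrices represent the same line when their rows span the same
  -- subspace.
  Lines : Setoid (c ⊔ ℓ) (c ⊔ ℓ)
  Lines = record
    { Carrier       = Line
    ; _≈_           = λ L M → ∀ v → v ∈Span matrix L ⇔ v ∈Span matrix M
    ; isEquivalence = record
      { refl  = λ _ → mk⇔ (λ s → s) (λ s → s)
      ; sym   = λ L≈M v → mk⇔ (Equivalence.from (L≈M v)) (Equivalence.to (L≈M v))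
      ; trans = λ L≈M M≈N v → mk⇔
          (Equivalence.to (M≈N v) ∘ Equivalence.to (L≈M v))
          (Equivalence.from (L≈M v) ∘ Equivalence.from (M≈N v))
      }
    }

  Skew : Matrix 2 4 → Matrix 2 4 → Set (c ⊔ ℓ)
  Skew L M = ∀ v → v ∈Span L → v ∈Span M → v ≋ 0ᵥ

  infix 4 _∝_
  _∝_ : ∀ {m n} → Matrix m n → Matrix m n → Set (c ⊔ ℓ)
  A ∝ B = ∃[ x ] (¬ x ≈ 0# × ∀ j k → A j k ≈ x * B j k)

  private
    ∝-refl : ∀ {m n} {A : Matrix m n} → A ∝ A
    ∝-refl {A = A} = 1# , 1≉0 , λ j k → sym (*-identityˡ (A j k))

    ∝-sym : ∀ {m n} {A B : Matrix m n} → A ∝ B → B ∝ A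
    ∝-sym {A = A} {B} (x , x≉0 , A≈xB) with inverse x x≉0
    ... | y , xy≈1 = y , y≉0 , λ j k → sym (begin
        y * A j k        ≈⟨ *-congˡ (A≈xB j k) ⟩
        y * (x * B j k)  ≈⟨ *-assoc y x (B j k) ⟨
        (y * x) * B j k  ≈⟨ *-congʳ (trans (*-comm y x) xy≈1) ⟩
        1# * B j k       ≈⟨ *-identityˡ (B j k) ⟩
        B j k            ∎)
      where
      y≉0 : ¬ y ≈ 0#
      y≉0 y≈0 = 1≉0 (trans (sym xy≈1) (trans (*-congˡ y≈0) (zeroʳ x)))

    ∝-trans : ∀ {m n} {A B C : Matrix m n} → A ∝ B → B ∝ C → A ∝ C
    ∝-trans {C = C} (x , x≉0 , A≈xB) (y , y≉0 , B≈yC) = x * y , xy≉0 , λ j k →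
        trans (A≈xB j k) (trans (*-congˡ (B≈yC j k)) (sym (*-assoc x y (C j k))))
      where
      xy≉0 : ¬ x * y ≈ 0#
      xy≉0 xy≈0 with inverse x x≉0
      ... | z , xz≈1 = y≉0 (begin
        y            ≈⟨ *-identityˡ y ⟨
        1# * y       ≈⟨ *-congʳ (trans (sym xz≈1) (*-comm x z)) ⟩
        (z * x) * y  ≈⟨ *-assoc z x y ⟩
        z * (x * y)  ≈⟨ *-congˡ xy≈0 ⟩
        z * 0#       ≈⟨ zeroʳ z ⟩
        0#           ∎)

  -- The symmetric matrix H with v H vᵀ = 2(x₀x₁ + x₂x₃).
  hyperbolicForm : Matrix 4 4
  hyperbolicForm = (0# ∷ 1# ∷ 0# ∷ 0# ∷ [])
                 ∷ (1# ∷ 0# ∷ 0# ∷ 0# ∷ [])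
                 ∷ (0# ∷ 0# ∷ 0# ∷ 1# ∷ [])
                 ∷ (0# ∷ 0# ∷ 1# ∷ 0# ∷ []) ∷ []

  -- In odd characteristic the quadric v Q vᵀ = 0 is represented by its
  -- symmetric matrix Q.  It is hyperbolic when it is projectively equivalent
  -- to x₀x₁ + x₂x₃ = 0.
  record HyperbolicQuadric : Set (c ⊔ ℓ) where
    field
      gram       : Matrix 4 4
      symmetric  : gram ᵀ ≈ₘ gram
      hyperbolic : ∃[ P ] (Invertible P × gram ∝ P · hyperbolicForm · P ᵀ)

  open HyperbolicQuadric public

  HyperbolicQuadrics : Setoid (c ⊔ ℓ) (c ⊔ ℓ)
  HyperbolicQuadrics = record
    { Carrier       = HyperbolicQuadric
    ; _≈_           = λ Q R → gram Q ∝ gram R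
    ; isEquivalence = record { refl = ∝-refl ; sym = ∝-sym ; trans = ∝-trans }
    }

  -- For a symmetric matrix in odd characteristic, the quadric contains every
  -- point of the line exactly when this matrix equation holds.
  ContainedIn : Matrix 2 4 → Matrix 4 4 → Set ℓ
  ContainedIn L Q = L · Q · L ᵀ ≈ₘ 0ₘ

  -- The matrix (I₂ 0) of the fixed line.
  L₀ : Matrix 2 4
  L₀ j = I 2 j ++ 0ᵥ {2}

  -- Up to row equivalence the members of 𝓛₁ are the (N I₂).
  𝓛₁ : Setoid (c ⊔ ℓ) (c ⊔ ℓ)
  𝓛₁ = SubsetOf Lines (λ L → Skew (matrix L) L₀)

  -- The members of 𝓗₁ have gram matrices (0 B; Bᵀ C) with B invertible and C
  -- symmetric.
  𝓗₁ : Setoid (c ⊔ ℓ) (c ⊔ ℓ)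
  𝓗₁ = SubsetOf HyperbolicQuadrics (λ Q → ContainedIn L₀ (gram Q))

  𝓛₁,𝓗₁ : IncidenceStructure (c ⊔ ℓ) (c ⊔ ℓ) (c ⊔ ℓ) (c ⊔ ℓ) ℓ
  𝓛₁,𝓗₁ = record
    { Points = 𝓛₁
    ; Blocks = 𝓗₁
    ; _∈_    = λ (L , _) (Q , _) → ContainedIn (matrix L) (gram Q)
    }

{-# OPTIONS --safe #-}
module Submission where

-- Points become 2 × 2 matrices N, and blocks become pairs of an invertible B and a symmetric C up
-- to a common scalar, with N on the block when NB + (NB)ᵀ + C = 0.  So NB has a fixed symmetric
-- part on a block and its skew part is a coordinate on it (q points), while the blocks on N are
-- given by B ∈ PGL₂ (q(q² - 1) blocks).  Two points of a block differ by K with KB alternating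
-- and nonzero, which makes K invertible and determines B up to a scalar; conversely every
-- invertible K arises.  Hence distinct points are joined exactly when det (N - M) ≠ 0.  For M on
-- the block (B, C), 4 det (N - M) det B = det T + z², where T = NB + (NB)ᵀ + C and z is the skew
-- part of (N - M)B.  So the points of the block that are joined to N correspond to the z with
-- z² ≠ - det T: there are q - 2, q - 1 or q of them, as - det T is a nonzero square, zero or a
-- nonsquare.

open import Defs
open import Algebra.Bundles using (CommutativeRing)
open import Algebra.Solver.Ring.AlmostCommutativeRing using (fromCommutativeRing; _-Raw-AlmostCommutative⟶_)
open import Data.Fin using (#_)
open import Data.Fin.Base as Fin using (Fin; punchIn; punchOut)
open import Data.Fin.Patterns using (0F; 1F; 2F; 3F)
import Data.Fin.Properties as Fin
open import Data.Integer.Base as ℤ using (ℤ; +_; -[1+_]; _⊖_)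
import Data.Integer.Properties as ℤ
open import Data.Bool.Base using (if_then_else_)
open import Data.Maybe.Base using (Maybe; just; nothing)
open import Data.Nat.Base as ℕ using (ℕ; zero; suc; _∸_)
open import Data.Nat.Divisibility using (_∣_; divides)
import Data.Nat.DivMod as ℕ
import Data.Nat.Properties as ℕ
open import Data.Nat.Solver using (module +-*-Solver)
open import Data.Product.Base using (∃₂; ∃-syntax; _×_; _,_; proj₁; proj₂)
open import Data.Product.Function.NonDependent.Setoid using (_×-inverse_)
open import Data.Product.Relation.Binary.Pointwise.NonDependent using (_×ₛ_; Pointwise-≡↔≡)
open import Data.Sum.Base using (inj₁; inj₂)
open import Data.Sum.Function.Setoid using (_⊎-inverse_)
open import Data.Sum.Relation.Binary.Pointwise as ⊎ using (_⊎ₛ_)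
import Data.Vec.Base as Vec
open import Function.Base using (_∘_; id)
open import Function.Bundles using (Inverse; _⇔_; mk⇔; Equivalence)
open import Function.Construct.Identity using () renaming (inverse to ↔-refl)
open import Function.Definitions using (Congruent; Injective; StrictlyInverseˡ)
open import Function.Properties.Inverse using () renaming (sym to ↔-sym; trans to ↔-trans)
open import Level using (Level; _⊔_)
open import Relation.Binary.Bundles using (Setoid)
open import Relation.Binary.Definitions using (Decidable)
open import Relation.Binary.PropositionalEquality as ≡ using (_≡_; _≢_)
open import Relation.Binary.Structures using (IsEquivalence)
open import Relation.Nullary.Decidable using (Dec; yes; no; does; map′)
open import Relation.Nullary.Negation using (¬_; contradiction)

-- The alternating 2 × 2 matrices are the multiples of J, where J₀₁ = 1 and J₁₀ = -1. So KB = μJ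
-- with μ ≠ 0 gives det K det B = μ², which makes K invertible, and B = μ K⁻¹J, which fixes B up to
-- a scalar; conversely any multiple of K⁻¹J serves as B. The factor 4 comes from det (S + zJ) = det
-- S + z² for symmetric S, applied to twice (N - M)B: its symmetric part is T for every M on the
-- block, so only z varies. Odd q enters through halving, through e ≠ - e for the count q - 2, and
-- through the existence of a nonsquare, which makes the value q occur. The obstacle is that lines
-- are matrices up to row span and quadrics are matrices up to scalars. The coordinates are
-- therefore shown to be an isomorphism of incidence structures. For this each (0 B; Bᵀ C) with det
-- B ≠ 0 has to be proved hyperbolic, by an explicit congruence with the standard form.

private
  variable
    a a₁ b b₁ c ℓ ℓ₁ ℓ₂ ℓa ℓa₁ ℓb ℓb₁ i₁ i₂ p p₁ p₂ : Level

-- Bijections of setoids and counting up to their equality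

module _ {S : Setoid a ℓ₁} {T : Setoid b ℓ₂} where
  private
    module S = Setoid S
    module T = Setoid T

  -- Injectivity makes the section congruent and a two-sided inverse. A section that is defined by a
  -- case distinction, such as a normal form, thus needs no congruence proof of its own.
  injectiveSection⇒inverse :
    (to : S.Carrier → T.Carrier) → Congruent S._≈_ T._≈_ to → Injective S._≈_ T._≈_ to →
    (from : T.Carrier → S.Carrier) → StrictlyInverseˡ T._≈_ to from → Inverse S T
  injectiveSection⇒inverse to cong injective from to∘from = record
    { to        = to
    ; from      = from
    ; to-cong   = cong
    ; from-cong = λ x≈y → injective (T.trans (to∘from _) (T.trans x≈y (T.sym (to∘from _))))
    ; inverse   = (λ {x} y≈ → T.trans (cong y≈) (to∘from x))
                , (λ x≈ → injective (T.trans (to∘from _) x≈))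
    }

  inverse-injective : (I : Inverse S T) → Injective S._≈_ T._≈_ (Inverse.to I)
  inverse-injective I eq = S.trans (S.sym (I.strictlyInverseʳ _)) (I.inverseʳ eq)
    where module I = Inverse I

  -- `SubsetOf` ignores the membership proofs in its equality. The second implication is stated
  -- along `from`, so neither predicate has to respect the equality.
  restrict : (I : Inverse S T) {P : S.Carrier → Set p₁} {Q : T.Carrier → Set p₂} →
             (∀ x → P x → Q (Inverse.to I x)) → (∀ y → Q y → P (Inverse.from I y)) →
             Inverse (SubsetOf S P) (SubsetOf T Q)
  restrict I P⇒Q Q⇒P = record
    { to        = λ (x , px) → I.to x , P⇒Q x px
    ; from      = λ (y , qy) → I.from y , Q⇒P y qy
    ; to-cong   = I.to-cong
    ; from-cong = I.from-cong
    ; inverse   = I.inverseˡ , I.inverseʳ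
    }
    where module I = Inverse I

module _ {S : Setoid a ℓ} where
  open Setoid S

  SubsetOf-× : {P : Carrier → Set p₁} {Q : Carrier → Set p₂} →
               Inverse (SubsetOf S (λ x → P x × Q x)) (SubsetOf (SubsetOf S P) (Q ∘ proj₁))
  SubsetOf-× = record
    { to        = λ (x , px , qx) → (x , px) , qx
    ; from      = λ ((x , px) , qx) → x , px , qx
    ; to-cong   = id
    ; from-cong = id
    ; inverse   = id , id
    }

  Exactly-resp-⇔ : ∀ {n} {P : Carrier → Set p₁} {Q : Carrier → Set p₂} →
                   (∀ x → P x ⇔ Q x) → Exactly n S P → Exactly n S Q
  Exactly-resp-⇔ P⇔Q = ↔-trans
    (restrict (↔-refl S) (λ x → Equivalence.from (P⇔Q x)) (λ x → Equivalence.to (P⇔Q x)))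

  Exactly-remove : ∀ {n} → HasSize S n → ∀ x → Exactly (n ∸ 1) S (λ y → ¬ y ≈ x)
  -- The element `x` excludes size 0, so the truncated `n ∸ 1` is the true predecessor.
  Exactly-remove {zero}  I x with () ← Inverse.to I x
  Exactly-remove {suc n} I x = injectiveSection⇒inverse
    (λ (y , y≉x) → punchOut (to≢ y≉x))
    (λ y≈z → Fin.punchOut-cong (I.to x) (I.to-cong y≈z))
    (λ {(y , y≉x)} {(z , z≉x)} eq → to-injective (Fin.punchOut-injective (to≢ y≉x) (to≢ z≉x) eq))
    (λ j → I.from (punchIn (I.to x) j) ,
           λ eq → Fin.punchInᵢ≢i (I.to x) j (≡.trans (≡.sym (I.strictlyInverseˡ _)) (I.to-cong eq)))
    (λ j → ≡.trans (Fin.punchOut-cong (I.to x) {i≢k = Fin.punchInᵢ≢i (I.to x) j ∘ ≡.sym} (I.strictlyInverseˡ _))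
                   (Fin.punchOut-punchIn (I.to x)))
    where
    module I = Inverse I
    to-injective : ∀ {y z} → I.to y ≡ I.to z → y ≈ z
    to-injective eq = trans (sym (I.strictlyInverseʳ _)) (I.inverseʳ eq)
    to≢ : ∀ {y} → ¬ y ≈ x → I.to x ≢ I.to y
    to≢ y≉x eq = y≉x (to-injective (≡.sym eq))

module _ {S : Setoid a ℓ₁} {T : Setoid b ℓ₂} {m n : ℕ} where

  HasSize-× : HasSize S m → HasSize T n → HasSize (S ×ₛ T) (m ℕ.* n)
  HasSize-× I J = ↔-trans (I ×-inverse J) (↔-trans Pointwise-≡↔≡ (↔-sym Fin.*↔×))

  HasSize-⊎ : HasSize S m → HasSize T n → HasSize (S ⊎ₛ T) (m ℕ.+ n)
  HasSize-⊎ I J = ↔-trans (I ⊎-inverse J) (↔-trans (⊎.Pointwise-≡↔≡ _ _) (↔-sym Fin.+↔⊎))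

-- A ring solver with integer coefficients

module IntegerCoefficientSolver (R : CommutativeRing c ℓ) where
  open CommutativeRing R
  open import Algebra.Properties.Semiring.Mult.TCOptimised semiring
    using (1+×; ×-homo-+; ×1-homo-*) renaming (_×_ to _×′_)
  open import Algebra.Properties.Ring ring using (-‿distribˡ-*; -‿distribʳ-*; -‿involutive; -0#≈0#; -‿+-comm)
  open import Relation.Binary.Reasoning.Setoid setoid

  private
    ⟦_⟧ : ℤ → Carrier
    ⟦ + n ⟧      = n ×′ 1#
    ⟦ -[1+ n ] ⟧ = - (suc n ×′ 1#)

    neg-homo : ∀ i → ⟦ ℤ.- i ⟧ ≈ - ⟦ i ⟧
    neg-homo (+ zero)   = sym -0#≈0#
    neg-homo (+ suc n)  = refl
    neg-homo -[1+ n ]   = sym (-‿involutive _)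

    ⊖-homo : ∀ m n → ⟦ m ⊖ n ⟧ ≈ m ×′ 1# + - (n ×′ 1#)
    ⊖-homo m       zero    = sym (trans (+-congˡ -0#≈0#) (+-identityʳ _))
    ⊖-homo zero    (suc n) = sym (+-identityˡ _)
    ⊖-homo (suc m) (suc n) = begin
      ⟦ suc m ⊖ suc n ⟧                      ≡⟨ ≡.cong ⟦_⟧ (ℤ.[1+m]⊖[1+n]≡m⊖n m n) ⟩
      ⟦ m ⊖ n ⟧                              ≈⟨ ⊖-homo m n ⟩
      m ×′ 1# + - (n ×′ 1#)                  ≈⟨ +-congʳ (+-identityˡ _) ⟨
      0# + m ×′ 1# + - (n ×′ 1#)             ≈⟨ +-congʳ (+-congʳ (-‿inverseʳ 1#)) ⟨
      1# + - 1# + m ×′ 1# + - (n ×′ 1#)      ≈⟨ +-congʳ (+-assoc _ _ _) ⟩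
      1# + (- 1# + m ×′ 1#) + - (n ×′ 1#)    ≈⟨ +-congʳ (+-congˡ (+-comm _ _)) ⟩
      1# + (m ×′ 1# + - 1#) + - (n ×′ 1#)    ≈⟨ +-congʳ (+-assoc _ _ _) ⟨
      1# + m ×′ 1# + - 1# + - (n ×′ 1#)      ≈⟨ +-assoc _ _ _ ⟩
      1# + m ×′ 1# + (- 1# + - (n ×′ 1#))    ≈⟨ +-congˡ (-‿+-comm _ _) ⟩
      1# + m ×′ 1# + - (1# + n ×′ 1#)        ≈⟨ +-cong (1+× m 1#) (-‿cong (1+× n 1#)) ⟨
      suc m ×′ 1# + - (suc n ×′ 1#)          ∎

    +-homo : ∀ i j → ⟦ i ℤ.+ j ⟧ ≈ ⟦ i ⟧ + ⟦ j ⟧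
    +-homo (+ m)    (+ n)    = ×-homo-+ 1# m n
    +-homo (+ m)    -[1+ n ] = ⊖-homo m (suc n)
    +-homo -[1+ m ] (+ n)    = trans (⊖-homo n (suc m)) (+-comm _ _)
    +-homo -[1+ m ] -[1+ n ] = begin
      - (suc (suc (m ℕ.+ n)) ×′ 1#)           ≡⟨ ≡.cong (λ k → - (suc k ×′ 1#)) (ℕ.+-suc m n) ⟨
      - ((suc m ℕ.+ suc n) ×′ 1#)             ≈⟨ -‿cong (×-homo-+ 1# (suc m) (suc n)) ⟩
      - (suc m ×′ 1# + suc n ×′ 1#)           ≈⟨ -‿+-comm _ _ ⟨
      - (suc m ×′ 1#) + - (suc n ×′ 1#)       ∎

    +*-homo : ∀ m j → ⟦ + m ℤ.* j ⟧ ≈ m ×′ 1# * ⟦ j ⟧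
    +*-homo m (+ n) = begin
      ⟦ + m ℤ.* + n ⟧         ≡⟨ ≡.cong ⟦_⟧ (ℤ.pos-* m n) ⟨
      (m ℕ.* n) ×′ 1#         ≈⟨ ×1-homo-* m n ⟩
      m ×′ 1# * n ×′ 1#       ∎
    +*-homo m -[1+ n ] = begin
      ⟦ + m ℤ.* -[1+ n ] ⟧          ≡⟨ ≡.cong ⟦_⟧ (ℤ.neg-distribʳ-* (+ m) (+ suc n)) ⟨
      ⟦ ℤ.- (+ m ℤ.* + suc n) ⟧     ≈⟨ neg-homo (+ m ℤ.* + suc n) ⟩
      - ⟦ + m ℤ.* + suc n ⟧         ≈⟨ -‿cong (+*-homo m (+ suc n)) ⟩
      - (m ×′ 1# * suc n ×′ 1#)     ≈⟨ -‿distribʳ-* _ _ ⟩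
      m ×′ 1# * - (suc n ×′ 1#)     ∎

    *-homo : ∀ i j → ⟦ i ℤ.* j ⟧ ≈ ⟦ i ⟧ * ⟦ j ⟧
    *-homo (+ m)    j = +*-homo m j
    *-homo -[1+ m ] j = begin
      ⟦ -[1+ m ] ℤ.* j ⟧            ≡⟨ ≡.cong ⟦_⟧ (ℤ.neg-distribˡ-* (+ suc m) j) ⟨
      ⟦ ℤ.- (+ suc m ℤ.* j) ⟧       ≈⟨ neg-homo (+ suc m ℤ.* j) ⟩
      - ⟦ + suc m ℤ.* j ⟧           ≈⟨ -‿cong (+*-homo (suc m) j) ⟩
      - (suc m ×′ 1# * ⟦ j ⟧)       ≈⟨ -‿distribˡ-* _ _ ⟩
      - (suc m ×′ 1#) * ⟦ j ⟧       ∎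

    -- Coefficients in ℤ have an equality test that computes, so normal forms reduce even though the
    -- ring is abstract, and identities with constants are closed by `refl`.
    morphism : ℤ.+-*-rawRing -Raw-AlmostCommutative⟶ fromCommutativeRing R
    morphism = record
      { ⟦_⟧    = ⟦_⟧
      ; +-homo = +-homo
      ; *-homo = *-homo
      ; -‿homo = neg-homo
      ; 0-homo = refl
      ; 1-homo = refl
      }

    _coeff≟_ : ∀ i j → Maybe (⟦ i ⟧ ≈ ⟦ j ⟧)
    i coeff≟ j with i ℤ.≟ j
    ... | yes i≡j = just (reflexive (≡.cong ⟦_⟧ i≡j))
    ... | no  _   = nothing

  open import Algebra.Solver.Ring ℤ.+-*-rawRing (fromCommutativeRing R) morphism _coeff≟_ public

-- Transport of generalized partial geometries along isomorphisms

module _ {𝓘 : IncidenceStructure a ℓa b ℓb i₁} {𝓙 : IncidenceStructure a₁ ℓa₁ b₁ ℓb₁ i₂} where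
  private
    module 𝓘 = IncidenceStructure 𝓘
    module 𝓙 = IncidenceStructure 𝓙

  module _ (f : Inverse 𝓘.Points 𝓙.Points) (g : Inverse 𝓘.Blocks 𝓙.Blocks)
           (∈⇔∈ : ∀ P B → P 𝓘.∈ B ⇔ Inverse.to f P 𝓙.∈ Inverse.to g B) where
    private
      module f = Inverse f
      module g = Inverse g
      module Points = Setoid 𝓙.Points
      module Blocks = Setoid 𝓙.Blocks

      f-injective = inverse-injective f
      g-injective = inverse-injective g

      ∈-to : ∀ {P B} → P 𝓘.∈ B → f.to P 𝓙.∈ g.to B
      ∈-to {P} {B} = Equivalence.to (∈⇔∈ P B)

      ∈-from : ∀ {P B} → f.to P 𝓙.∈ g.to B → P 𝓘.∈ B
      ∈-from {P} {B} = Equivalence.from (∈⇔∈ P B)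

    -- Incidence in `𝓘` is not assumed to respect equality of points or of blocks. Every such
    -- replacement is made in `𝓙`, where it is an axiom for points and one half of extensionality
    -- for blocks.
    isomorphic⇒isGeneralizedPartialGeometry :
      ∀ {r s t} {αs : Vec.Vec ℕ r} →
      IsGeneralizedPartialGeometry 𝓙 r s t αs → IsGeneralizedPartialGeometry 𝓘 r s t αs
    isomorphic⇒isGeneralizedPartialGeometry {αs = αs} 𝓙-isGPG = record
      { ∈-resp-≈ₚ        = λ B P≈Q → ∈-from ∘ J.∈-resp-≈ₚ (g.to B) (f.to-cong P≈Q) ∘ ∈-to
      ; extensionality   = λ B C → mk⇔
          (λ B≈C P → let module E = Equivalence (Equivalence.to (J.extensionality _ _) (g.to-cong B≈C) (f.to P))
                     in mk⇔ (∈-from ∘ E.to ∘ ∈-to) (∈-from ∘ E.from ∘ ∈-to))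
          (λ B⇔C → g-injective (Equivalence.from (J.extensionality _ _) λ P → mk⇔
            (∈-to-from ∘ Equivalence.to (B⇔C (f.from P)) ∘ ∈-from-to)
            (∈-to-from ∘ Equivalence.from (B⇔C (f.from P)) ∘ ∈-from-to)))
      ; finite           = proj₁ J.finite , ↔-trans f (proj₂ J.finite)
      ; non-empty        = f.from J.non-empty
      ; common-block     = λ P≉Q P∈B Q∈B P∈C Q∈C → g-injective
          (J.common-block (P≉Q ∘ f-injective) (∈-to P∈B) (∈-to Q∈B) (∈-to P∈C) (∈-to Q∈C))
      ; points-per-block = λ B → ↔-trans
          (restrict f (λ _ → ∈-to) (λ _ → ∈-from-to)) (J.points-per-block (g.to B))
      ; blocks-per-point = λ P → ↔-trans
          (restrict g (λ _ → ∈-to) (λ _ → ∈-from ∘ ∈-resp-≈ᵦ (Blocks.sym (g.strictlyInverseˡ _))))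
          (J.blocks-per-point (f.to P))
      ; joined           = λ P B P∉B → let j , I = J.joined (f.to P) (g.to B) (P∉B ∘ ∈-from)
                                       in j , joinedPointsOf I
      ; attained         = λ j → attained (J.attained j)
      }
      where
      module J = IsGeneralizedPartialGeometry 𝓙-isGPG

      ∈-resp-≈ᵦ : ∀ {P B C} → B 𝓙.≈ᵦ C → P 𝓙.∈ B → P 𝓙.∈ C
      ∈-resp-≈ᵦ {P} B≈C = Equivalence.to (Equivalence.to (J.extensionality _ _) B≈C P)

      ∈-from-to : ∀ {P B} → P 𝓙.∈ g.to B → f.from P 𝓘.∈ B
      ∈-from-to = ∈-from ∘ J.∈-resp-≈ₚ _ (Points.sym (f.strictlyInverseˡ _))

      ∈-to-from : ∀ {P B} → f.from P 𝓘.∈ B → P 𝓙.∈ g.to B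
      ∈-to-from = J.∈-resp-≈ₚ _ (f.strictlyInverseˡ _) ∘ ∈-to

      joinedPointsOf : ∀ {P B n} → 𝓙.JoinedPointsOf (g.to B) (f.to P) n → 𝓘.JoinedPointsOf B P n
      joinedPointsOf = ↔-trans (restrict f
        (λ _ (Q∈B , C , P∈C , Q∈C) → ∈-to Q∈B , g.to C , ∈-to P∈C , ∈-to Q∈C)
        (λ _ (Q∈B , C , P∈C , Q∈C) →
          ∈-from-to Q∈B , g.from C ,
          ∈-from (∈-resp-≈ᵦ (Blocks.sym (g.strictlyInverseˡ _)) P∈C) ,
          ∈-from-to (∈-resp-≈ᵦ (Blocks.sym (g.strictlyInverseˡ _)) Q∈C)))

      attained : ∀ {n} → ∃₂ (λ P B → ¬ P 𝓙.∈ B × 𝓙.JoinedPointsOf B P n) →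
                 ∃₂ (λ P B → ¬ P 𝓘.∈ B × 𝓘.JoinedPointsOf B P n)
      attained (P , B , P∉B , I) =
        f.from P , g.from B ,
        P∉B ∘ ∈-resp-≈ᵦ gB≈B ∘ ∈-to-from ,
        -- `joinedPointsOf` expects a count at a pair of images, so the count at `P` and `B` is
        -- first moved to the equal pair `f.to (f.from P)`, `g.to (g.from B)`.
        joinedPointsOf (↔-trans (restrict (↔-refl 𝓙.Points)
          (λ _ (Q∈B , C , P∈C , Q∈C) → ∈-resp-≈ᵦ gB≈B Q∈B , C , J.∈-resp-≈ₚ C fP≈P P∈C , Q∈C)
          (λ _ (Q∈B , C , P∈C , Q∈C) →
            ∈-resp-≈ᵦ (Blocks.sym gB≈B) Q∈B , C , J.∈-resp-≈ₚ C (Points.sym fP≈P) P∈C , Q∈C)) I)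
        where
        gB≈B = g.strictlyInverseˡ B
        fP≈P = f.strictlyInverseˡ P

-- Finite fields: characteristic and squares

module FieldProperties {c ℓ q} (F : FiniteField c ℓ q) where
  open FiniteField F
  open import Algebra.Properties.Group +-group
    using () renaming (x≈y⇒x∙y⁻¹≈ε to x≈y⇒x-y≈0; x∙y⁻¹≈ε⇒x≈y to x-y≈0⇒x≈y)
  open import Relation.Binary.Reasoning.Setoid setoid
  open IntegerCoefficientSolver commutativeRing

  private
    module size = Inverse size

  infix 4 _≟_
  _≟_ : Decidable _≈_
  x ≟ y = map′ (inverse-injective size) size.to-cong (size.to x Fin.≟ size.to y)

  x≈0∧y≈0⇒x+y≈0 : ∀ {x y} → x ≈ 0# → y ≈ 0# → x + y ≈ 0#
  x≈0∧y≈0⇒x+y≈0 x≈0 y≈0 = trans (+-cong x≈0 y≈0) (+-identityˡ 0#)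

  x≈0⇒y*x≈0 : ∀ {x} y → x ≈ 0# → y * x ≈ 0#
  x≈0⇒y*x≈0 y x≈0 = trans (*-congˡ x≈0) (zeroʳ y)

  -- For the right cofactor k the last hypothesis is a ring identity, within reach of the solver.
  ≈-by-multiple : ∀ {x y l r} → l ≈ r → ∀ k → x - y ≈ k * (l - r) → x ≈ y
  ≈-by-multiple l≈r k x-y≈ = x-y≈0⇒x≈y _ _ (trans x-y≈ (x≈0⇒y*x≈0 k (x≈y⇒x-y≈0 l≈r)))

  ≈-by-multiples : ∀ {x y l r l′ r′} → l ≈ r → l′ ≈ r′ → ∀ k k′ →
                   x - y ≈ k * (l - r) + k′ * (l′ - r′) → x ≈ y
  ≈-by-multiples l≈r l′≈r′ k k′ x-y≈ = x-y≈0⇒x≈y _ _ (trans x-y≈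
    (x≈0∧y≈0⇒x+y≈0 (x≈0⇒y*x≈0 k (x≈y⇒x-y≈0 l≈r)) (x≈0⇒y*x≈0 k′ (x≈y⇒x-y≈0 l′≈r′))))

  *-cancelˡ-nonZero : ∀ {x y z} → ¬ x ≈ 0# → x * y ≈ x * z → y ≈ z
  *-cancelˡ-nonZero {x} {y} {z} x≉0 xy≈xz = let i , xi≈1 = inverse x x≉0 in
    ≈-by-multiples xy≈xz xi≈1 i (z - y)
      (solve 4 (λ x y z i → y :- z := i :* (x :* y :- x :* z) :+ (z :- y) :* (x :* i :- con (+ 1)))
        refl x y z i)

  *-nonZero : ∀ {x y} → ¬ x ≈ 0# → ¬ y ≈ 0# → ¬ x * y ≈ 0#
  *-nonZero {x} x≉0 y≉0 xy≈0 = y≉0 (*-cancelˡ-nonZero x≉0 (trans xy≈0 (sym (zeroʳ x))))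

  *≈0∧≉0⇒≈0 : ∀ {x y} → ¬ x ≈ 0# → x * y ≈ 0# → y ≈ 0#
  *≈0∧≉0⇒≈0 {x} x≉0 xy≈0 = *-cancelˡ-nonZero x≉0 (trans xy≈0 (sym (zeroʳ x)))

  square≈0⇒≈0 : ∀ {x} → x * x ≈ 0# → x ≈ 0#
  square≈0⇒≈0 {x} x²≈0 with x ≟ 0#
  ... | yes x≈0 = x≈0
  ... | no  x≉0 = contradiction x²≈0 (*-nonZero x≉0 x≉0)

  -x≈0⇒x≈0 : ∀ {x} → - x ≈ 0# → x ≈ 0#
  -x≈0⇒x≈0 {x} -x≈0 = ≈-by-multiple -x≈0 (- 1#)
    (solve 1 (λ x → x :- con (+ 0) := :- con (+ 1) :* (:- x :- con (+ 0))) refl x)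

  *-nonZeroˡ : ∀ {x y} → ¬ x * y ≈ 0# → ¬ x ≈ 0#
  *-nonZeroˡ {y = y} xy≉0 x≈0 = xy≉0 (trans (*-congʳ x≈0) (zeroˡ y))

  *-nonZeroʳ : ∀ {x y} → ¬ x * y ≈ 0# → ¬ y ≈ 0#
  *-nonZeroʳ {x = x} xy≉0 y≈0 = xy≉0 (x≈0⇒y*x≈0 x y≈0)

  recip : ∀ x → ¬ x ≈ 0# → Carrier
  recip x x≉0 = proj₁ (inverse x x≉0)

  recip-inverseʳ : ∀ x x≉0 → x * recip x x≉0 ≈ 1#
  recip-inverseʳ x x≉0 = proj₂ (inverse x x≉0)

  recip-nonZero : ∀ x x≉0 → ¬ recip x x≉0 ≈ 0#
  recip-nonZero x x≉0 = *-nonZeroʳ (λ eq → 1≉0 (trans (sym (recip-inverseʳ x x≉0)) eq))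

  -- Summing x and x + 1 over the whole field gives the same result, so q · 1 = 0.
  module _ where
    open import Algebra.Properties.Semiring.Sum semiring
      using (sum; sum-cong-≋; sum-permute; sum-replicate; ∑-distrib-+)
    open import Algebra.Properties.Monoid.Mult +-monoid
      using (×-congˡ; ×-congʳ; ×-homo-+; ×-assocˡ) renaming (_×_ to _×ₙ_)
    open import Algebra.Properties.Group +-group using (identityʳ-unique)

    translation : Carrier → Inverse setoid setoid
    translation x = injectiveSection⇒inverse
      (_+ x) +-congʳ
      (λ {y} {z} y+x≈z+x → ≈-by-multiple y+x≈z+x 1#
        (solve 3 (λ x y z → y :- z := con (+ 1) :* (y :+ x :- (z :+ x))) refl x y z))
      (_- x) (λ y → solve 2 (λ x y → y :- x :+ x := y) refl x y)

    q×1≈0 : q ×ₙ 1# ≈ 0#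
    q×1≈0 = identityʳ-unique (sum size.from) _ (begin
      sum size.from + q ×ₙ 1#                              ≈⟨ +-congˡ (sum-replicate q) ⟨
      sum size.from + sum {q} (λ _ → 1#)                   ≈⟨ ∑-distrib-+ size.from (λ _ → 1#) ⟨
      sum (λ j → size.from j + 1#)                         ≈⟨ sum-cong-≋ {q} (λ j → size.strictlyInverseʳ _) ⟨
      sum (λ j → size.from (size.to (size.from j + 1#)))   ≈⟨ sum-permute size.from
                                                              (↔-trans (↔-sym size) (↔-trans (translation 1#) size)) ⟨
      sum size.from                                        ∎)

    -- For q = 1 + 2k, the multiple q · 1 would be 1 if 2 vanished, but it is 0.
    odd⇒2≉0 : ¬ 2 ∣ q → ¬ 1# + 1# ≈ 0#
    odd⇒2≉0 2∤q 2≈0 with q ℕ.% 2 | ℕ.m%n<n q 2 | ℕ.m≡m%n+[m/n]*n q 2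
    ... | 0 | _ | q≡ = 2∤q (divides (q ℕ./ 2) q≡)
    ... | 1 | _ | q≡ = 1≉0 (begin
      1#                                  ≈⟨ +-identityʳ 1# ⟨
      1 ×ₙ 1#                             ≈⟨ +-identityʳ _ ⟨
      1 ×ₙ 1# + 0#                        ≈⟨ +-congˡ (×ₙ-0 (q ℕ./ 2)) ⟨
      1 ×ₙ 1# + (q ℕ./ 2) ×ₙ 0#           ≈⟨ +-congˡ (×-congʳ (q ℕ./ 2) (trans (+-congˡ (+-identityʳ 1#)) 2≈0)) ⟨
      1 ×ₙ 1# + (q ℕ./ 2) ×ₙ (2 ×ₙ 1#)    ≈⟨ +-congˡ (×-assocˡ 1# (q ℕ./ 2) 2) ⟩
      1 ×ₙ 1# + (q ℕ./ 2 ℕ.* 2) ×ₙ 1#     ≈⟨ ×-homo-+ 1# 1 (q ℕ./ 2 ℕ.* 2) ⟨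
      (1 ℕ.+ q ℕ./ 2 ℕ.* 2) ×ₙ 1#         ≈⟨ ×-congˡ q≡ ⟨
      q ×ₙ 1#                             ≈⟨ q×1≈0 ⟩
      0#                                  ∎)
      where
      ×ₙ-0 : ∀ n → n ×ₙ 0# ≈ 0#
      ×ₙ-0 zero    = refl
      ×ₙ-0 (suc n) = trans (+-identityˡ _) (×ₙ-0 n)
    ... | suc (suc _) | ℕ.s≤s (ℕ.s≤s ()) | _

  IsSquare : Carrier → Set (c ⊔ ℓ)
  IsSquare x = ∃[ y ] y * y ≈ x

  isSquare? : ∀ x → Dec (IsSquare x)
  isSquare? x = map′
    (λ (j , eq) → size.from j , eq)
    (λ (y , eq) → size.to y , trans (*-cong (size.strictlyInverseʳ y) (size.strictlyInverseʳ y)) eq)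
    (Fin.any? (λ j → size.from j * size.from j ≟ x))

  square≉-nonSquare : ∀ {d} → ¬ IsSquare d → Exactly q setoid (λ z → ¬ z * z ≈ d)
  square≉-nonSquare ¬sq = injectiveSection⇒inverse
    (size.to ∘ proj₁) size.to-cong (inverse-injective size)
    (λ j → size.from j , λ z²≈d → ¬sq (_ , z²≈d)) size.strictlyInverseˡ

  square≉0 : ∀ {d} → d ≈ 0# → Exactly (q ∸ 1) setoid (λ z → ¬ z * z ≈ d)
  square≉0 d≈0 = Exactly-resp-⇔
    (λ z → mk⇔ (λ z≉0 z²≈d → *-nonZero z≉0 z≉0 (trans z²≈d d≈0))
               (λ z²≉d z≈0 → z²≉d (trans (x≈0⇒y*x≈0 z z≈0) (sym d≈0))))
    (Exactly-remove size 0#)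

  x²≈y²∧x≉y⇒x≈-y : ∀ {x y} → x * x ≈ y * y → ¬ x ≈ y → x ≈ - y
  x²≈y²∧x≉y⇒x≈-y {x} {y} x²≈y² x≉y = ≈-by-multiple {r = 0#}
    (*≈0∧≉0⇒≈0 {y = x + y} (x≉y ∘ x-y≈0⇒x≈y x y)
      (≈-by-multiple x²≈y² 1#
        (solve 2 (λ x y → (x :- y) :* (x :+ y) :- con (+ 0) := con (+ 1) :* (x :* x :- y :* y)) refl x y)))
    1# (solve 2 (λ x y → x :- :- y := con (+ 1) :* (x :+ y :- con (+ 0))) refl x y)

  module OddCharacteristic (2≉0 : ¬ 1# + 1# ≈ 0#) where

    ½ : Carrier
    ½ = recip (1# + 1#) 2≉0

    2*½≈1 : (1# + 1#) * ½ ≈ 1#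
    2*½≈1 = recip-inverseʳ (1# + 1#) 2≉0

    4≉0 : ¬ (1# + 1#) * (1# + 1#) ≈ 0#
    4≉0 = *-nonZero 2≉0 2≉0

    x+x≈0⇒x≈0 : ∀ {x} → x + x ≈ 0# → x ≈ 0#
    x+x≈0⇒x≈0 {x} x+x≈0 = *≈0∧≉0⇒≈0 2≉0 (trans
      (solve 1 (λ x → (con (+ 1) :+ con (+ 1)) :* x := x :+ x) refl x) x+x≈0)

    x≈-x⇒x≈0 : ∀ {x} → x ≈ - x → x ≈ 0#
    x≈-x⇒x≈0 {x} x≈-x = *≈0∧≉0⇒≈0 2≉0 (≈-by-multiple x≈-x 1#
      (solve 1 (λ x → (con (+ 1) :+ con (+ 1)) :* x :- con (+ 0) := con (+ 1) :* (x :- :- x)) refl x))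

    -- A choice of square roots would be an injection of the field into itself missing - √1.
    ¬allSquares : ¬ (∀ j → IsSquare (size.from j))
    ¬allSquares all = contradiction (Fin.injective⇒≤ {f = index} index-injective) (ℕ.<⇒≱ (pred< (size.to 0#)))
      where
      √ : Fin q → Carrier
      √ j = proj₁ (all j)

      √-injective : ∀ {j k} → √ j * √ j ≈ √ k * √ k → j ≡ k
      √-injective {j} {k} eq = inverse-injective (↔-sym size)
        (trans (sym (proj₂ (all j))) (trans eq (proj₂ (all k))))

      one : Fin q
      one = size.to 1#

      -- Squaring `√ j ≈ - √ one` gives `j ≡ one`; then `√ one` is its own negative, hence zero,
      -- although its square is 1.
      √≉-√1 : ∀ j → ¬ √ j ≈ - √ one
      √≉-√1 j √j≈-√1 = 1≉0 (begin
        1#                ≈⟨ size.strictlyInverseʳ 1# ⟨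
        size.from one     ≈⟨ proj₂ (all one) ⟨
        √ one * √ one     ≈⟨ x≈0⇒y*x≈0 (√ one) (x≈-x⇒x≈0 (trans (reflexive (≡.cong √ (≡.sym j≡1))) √j≈-√1)) ⟩
        0#                ∎)
        where
        j≡1 : j ≡ one
        j≡1 = √-injective (trans (*-cong √j≈-√1 √j≈-√1)
          (solve 1 (λ x → :- x :* :- x := x :* x) refl (√ one)))

      others : Exactly (q ∸ 1) setoid (λ y → ¬ y ≈ - √ one)
      others = Exactly-remove size (- √ one)

      index : Fin q → Fin (q ∸ 1)
      index j = Inverse.to others (√ j , √≉-√1 j)

      index-injective : Injective _≡_ _≡_ index
      index-injective {j} {k} eq =
        let √j≈√k = inverse-injective others {√ j , √≉-√1 j} {√ k , √≉-√1 k} eq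
        in √-injective (*-cong √j≈√k √j≈√k)

      pred< : ∀ {n} → Fin n → n ∸ 1 ℕ.< n
      pred< {suc n} _ = ℕ.n<1+n n

    nonSquare : ∃[ x ] ¬ IsSquare x
    nonSquare = let j , ¬sq = Fin.¬∀⟶∃¬ q _ (λ j → isSquare? (size.from j)) ¬allSquares in size.from j , ¬sq

    -- The roots of a nonzero square are `e` and `- e`, distinct in odd characteristic. They are
    -- removed one after the other, which gives `q ∸ 1 ∸ 1`.
    square≉-square : ∀ {d e} → e * e ≈ d → ¬ d ≈ 0# → Exactly (q ∸ 2) setoid (λ z → ¬ z * z ≈ d)
    square≉-square {d} {e} e²≈d d≉0 = ≡.subst (λ n → Exactly n setoid (λ z → ¬ z * z ≈ d)) (ℕ.∸-+-assoc q 1 1)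
      (↔-trans removeBoth (Exactly-remove {S = SubsetOf setoid (λ z → ¬ z ≈ e)} (Exactly-remove size e) (- e , -e≉e)))
      where
      e≉0 : ¬ e ≈ 0#
      e≉0 e≈0 = d≉0 (trans (sym e²≈d) (x≈0⇒y*x≈0 e e≈0))

      -e≉e : ¬ - e ≈ e
      -e≉e -e≈e = e≉0 (x≈-x⇒x≈0 (sym -e≈e))

      removeBoth : Inverse (SubsetOf setoid (λ z → ¬ z * z ≈ d))
                          (SubsetOf (SubsetOf setoid (λ z → ¬ z ≈ e)) (λ z → ¬ proj₁ z ≈ - e))
      removeBoth = injectiveSection⇒inverse
        (λ (z , z²≉d) → (z , λ z≈e → z²≉d (trans (*-cong z≈e z≈e) e²≈d)) ,
          λ z≈-e → z²≉d (trans (*-cong z≈-e z≈-e)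
            (trans (solve 1 (λ x → :- x :* :- x := x :* x) refl e) e²≈d)))
        id id
        (λ ((z , z≉e) , z≉-e) → z , λ z²≈d → z≉-e (x²≈y²∧x≉y⇒x≈-y (trans z²≈d (sym e²≈d)) z≉e))
        (λ _ → refl)

    square≉-count : ∀ d →
      ∃[ j ] Exactly (Vec.lookup (q ∸ 2 Vec.∷ q ∸ 1 Vec.∷ q Vec.∷ Vec.[]) j) setoid (λ z → ¬ z * z ≈ d)
    square≉-count d with isSquare? d | d ≟ 0#
    ... | no ¬sq         | _       = 2F , square≉-nonSquare ¬sq
    ... | yes _          | yes d≈0 = 1F , square≉0 d≈0
    ... | yes (e , e²≈d) | no d≉0  = 0F , square≉-square e²≈d d≉0

-- Matrices and determinants

entries₂ : {P : Fin 2 → Set p} → P 0F → P 1F → ∀ j → P j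
entries₂ p₀ p₁ 0F = p₀
entries₂ p₀ p₁ 1F = p₁

entries₄ : {P : Fin 4 → Set p} → P 0F → P 1F → P 2F → P 3F → ∀ j → P j
entries₄ p₀ p₁ p₂ p₃ 0F = p₀
entries₄ p₀ p₁ p₂ p₃ 1F = p₁
entries₄ p₀ p₁ p₂ p₃ 2F = p₂
entries₄ p₀ p₁ p₂ p₃ 3F = p₃

module MatrixProperties {c ℓ q} (F : FiniteField c ℓ q) where
  open FiniteField F
  open import Data.Vec.Functional using (Vector; []; _∷_)
  open ProjectiveSpace F
  open FieldProperties F
  open IntegerCoefficientSolver commutativeRing
  open import Algebra.Properties.Semiring.Sum semiring
    using (sum; sum-cong-≋; sum-replicate-zero; ∑-comm; *-distribˡ-sum; *-distribʳ-sum)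
  open import Algebra.Properties.Group +-group
    using () renaming (x≈y⇒x∙y⁻¹≈ε to x≈y⇒x-y≈0; x∙y⁻¹≈ε⇒x≈y to x-y≈0⇒x≈y)
  open import Relation.Binary.Reasoning.Setoid setoid

  private
    variable
      l m n : ℕ

  sum-zero : {v : Vector Carrier n} → v ≋ 0ᵥ → sum v ≈ 0#
  sum-zero {n} v≋0 = trans (sum-cong-≋ v≋0) (sum-replicate-zero n)

  ∙-congʳ : {u v : Vector Carrier m} (A : Matrix m n) → u ≋ v → u ∙ A ≋ v ∙ A
  ∙-congʳ A u≋v k = sum-cong-≋ λ j → *-congʳ (u≋v j)

  ∙-congˡ : (v : Vector Carrier m) {A B : Matrix m n} → A ≈ₘ B → v ∙ A ≋ v ∙ B
  ∙-congˡ v A≈B k = sum-cong-≋ λ j → *-congˡ (A≈B j k)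

  ∙-zeroˡ : {v : Vector Carrier m} (A : Matrix m n) → v ≋ 0ᵥ → v ∙ A ≋ 0ᵥ
  ∙-zeroˡ A v≋0 k = sum-zero λ j → trans (*-congʳ (v≋0 j)) (zeroˡ _)

  ∙-zeroʳ : (v : Vector Carrier m) {A : Matrix m n} → A ≈ₘ 0ₘ → v ∙ A ≋ 0ᵥ
  ∙-zeroʳ v A≈0 k = sum-zero λ j → x≈0⇒y*x≈0 _ (A≈0 j k)

  ∙-scale : (v : Vector Carrier m) {A B : Matrix m n} {x : Carrier} →
            (∀ j k → A j k ≈ x * B j k) → ∀ k → (v ∙ A) k ≈ x * (v ∙ B) k
  ∙-scale v {A} {B} {x} A≈xB k = begin
    sum (λ j → v j * A j k)          ≈⟨ sum-cong-≋ (λ j → *-congˡ (A≈xB j k)) ⟩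
    sum (λ j → v j * (x * B j k))    ≈⟨ sum-cong-≋ (λ j → swap (v j) (B j k)) ⟩
    sum (λ j → x * (v j * B j k))    ≈⟨ *-distribˡ-sum x (λ j → v j * B j k) ⟨
    x * sum (λ j → v j * B j k)      ∎
    where
    swap : ∀ a b → a * (x * b) ≈ x * (a * b)
    swap a b = solve 3 (λ x a b → a :* (x :* b) := x :* (a :* b)) refl x a b

  ∙-assoc : (v : Vector Carrier l) (A : Matrix l m) (B : Matrix m n) → (v ∙ A) ∙ B ≋ v ∙ (A · B)
  ∙-assoc v A B k = begin
    sum (λ j → sum (λ i → v i * A i j) * B j k)      ≈⟨ sum-cong-≋ (λ j → *-distribʳ-sum (B j k) (λ i → v i * A i j)) ⟩
    sum (λ j → sum (λ i → v i * A i j * B j k))      ≈⟨ ∑-comm (λ j i → v i * A i j * B j k) ⟩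
    sum (λ i → sum (λ j → v i * A i j * B j k))      ≈⟨ sum-cong-≋ (λ i → sum-cong-≋ (λ j → *-assoc (v i) (A i j) (B j k))) ⟩
    sum (λ i → sum (λ j → v i * (A i j * B j k)))    ≈⟨ sum-cong-≋ (λ i → *-distribˡ-sum (v i) (λ j → A i j * B j k)) ⟨
    sum (λ i → v i * sum (λ j → A i j * B j k))      ∎

  -- The induction goes through because `does` of the index comparison at two successors reduces to
  -- the comparison of their predecessors, so the lower right corner of `I (suc n)` unfolds to
  -- `I n`.
  sum-I : ∀ j (f : Vector Carrier n) → sum (λ k → I n j k * f k) ≈ f j
  sum-I {suc n} 0F f = begin
    1# * f 0F + sum (λ k → 0# * f (Fin.suc k))   ≈⟨ +-cong (*-identityˡ _) (sum-zero λ k → zeroˡ (f (Fin.suc k))) ⟩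
    f 0F + 0#                                    ≈⟨ +-identityʳ _ ⟩
    f 0F                                         ∎
  sum-I {suc n} (Fin.suc j) f = begin
    0# * f 0F + sum (λ k → I n j k * f (Fin.suc k))   ≈⟨ +-cong (zeroˡ _) (sum-I j (f ∘ Fin.suc)) ⟩
    0# + f (Fin.suc j)                                ≈⟨ +-identityˡ _ ⟩
    f (Fin.suc j)                                     ∎

  I-symmetric : ∀ (j k : Fin n) → I n j k ≈ I n k j
  I-symmetric 0F          0F          = refl
  I-symmetric 0F          (Fin.suc k) = refl
  I-symmetric (Fin.suc j) 0F          = refl
  I-symmetric (Fin.suc j) (Fin.suc k) = I-symmetric j k

  I-∙ : ∀ j (A : Matrix m n) → I m j ∙ A ≋ A j
  I-∙ j A k = sum-I j (λ i → A i k)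

  ∙-I : (v : Vector Carrier n) → v ∙ I n ≋ v
  ∙-I v k = begin
    sum (λ j → v j * I _ j k)    ≈⟨ sum-cong-≋ (λ j → trans (*-comm _ _) (*-congʳ (I-symmetric j k))) ⟩
    sum (λ j → I _ k j * v j)    ≈⟨ sum-I k v ⟩
    v k                          ∎

  ·-ᵀ : (A : Matrix l m) (B : Matrix m n) → (A · B) ᵀ ≈ₘ B ᵀ · A ᵀ
  ·-ᵀ A B j k = sum-cong-≋ λ i → *-comm (A k i) (B i j)

  _-ᵥ_ : Vector Carrier n → Vector Carrier n → Vector Carrier n
  (u -ᵥ v) k = u k - v k

  -ᵥ-∙ : (u v : Vector Carrier 2) (A : Matrix 2 n) → ∀ k → ((u -ᵥ v) ∙ A) k ≈ (u ∙ A) k - (v ∙ A) k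
  -ᵥ-∙ u v A k = solve 6 (λ u₀ u₁ v₀ v₁ a b →
    (u₀ :- v₀) :* a :+ ((u₁ :- v₁) :* b :+ con (+ 0)) :=
    u₀ :* a :+ (u₁ :* b :+ con (+ 0)) :- (v₀ :* a :+ (v₁ :* b :+ con (+ 0)))) refl
    (u 0F) (u 1F) (v 0F) (v 1F) (A 0F k) (A 1F k)

  independentRows⇒∙-cancel : {A : Matrix 2 n} → IndependentRows A → ∀ {u v} → u ∙ A ≋ v ∙ A → u ≋ v
  independentRows⇒∙-cancel {A = A} indep {u} {v} uA≋vA k = x-y≈0⇒x≈y _ _
    (indep (u -ᵥ v) (λ j → trans (-ᵥ-∙ u v A j) (x≈y⇒x-y≈0 (uA≋vA j))) k)

  invertible⇒independentRows : {A : Matrix n n} → Invertible A → IndependentRows A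
  invertible⇒independentRows {A = A} (B , AB≈I , _) v vA≋0 k = begin
    v k                ≈⟨ ∙-I v k ⟨
    (v ∙ I _) k        ≈⟨ ∙-congˡ v AB≈I k ⟨
    (v ∙ (A · B)) k    ≈⟨ ∙-assoc v A B k ⟨
    (v ∙ A ∙ B) k      ≈⟨ ∙-zeroˡ B vA≋0 k ⟩
    0#                 ∎

  ᵀ-invertible : {A : Matrix n n} → Invertible A → Invertible (A ᵀ)
  ᵀ-invertible {A = A} (B , AB≈I , BA≈I) = B ᵀ ,
    (λ j k → trans (sym (·-ᵀ B A j k)) (trans (BA≈I k j) (I-symmetric k j))) ,
    (λ j k → trans (sym (·-ᵀ A B j k)) (trans (AB≈I k j) (I-symmetric k j)))

  det : Matrix 2 2 → Carrier
  det A = A 0F 0F * A 1F 1F - A 0F 1F * A 1F 0F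

  det-· : ∀ A B → det (A · B) ≈ det A * det B
  det-· A B = solve 8 (λ a b c d e f g h →
    (a :* e :+ (b :* g :+ con (+ 0))) :* (c :* f :+ (d :* h :+ con (+ 0))) :-
    (a :* f :+ (b :* h :+ con (+ 0))) :* (c :* e :+ (d :* g :+ con (+ 0)))
    := (a :* d :- b :* c) :* (e :* h :- f :* g)) refl
    (A 0F 0F) (A 0F 1F) (A 1F 0F) (A 1F 1F) (B 0F 0F) (B 0F 1F) (B 1F 0F) (B 1F 1F)

  -- When det A = 0, the rows of the adjugate of A are in its left kernel.
  independentRows⇒det≉0 : ∀ {A} → IndependentRows A → ¬ det A ≈ 0#
  independentRows⇒det≉0 {A} indep det≈0 = 1≉0 (indep (1# ∷ 0# ∷ []) (entries₂ (first 0F a₀₀≈0) (first 1F a₀₁≈0)) 0F)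
    where
    first : ∀ k → A 0F k ≈ 0# → 1# * A 0F k + (0# * A 1F k + 0#) ≈ 0#
    first k a≈0 = trans
      (solve 2 (λ a b → con (+ 1) :* a :+ (con (+ 0) :* b :+ con (+ 0)) := a) refl (A 0F k) (A 1F k)) a≈0

    a₀₁≈0 : A 0F 1F ≈ 0#
    a₀₁≈0 = -x≈0⇒x≈0 (indep (A 1F 1F ∷ - A 0F 1F ∷ []) (entries₂
      (≈-by-multiple det≈0 1# (solve 4 (λ a b c d →
        d :* a :+ (:- b :* c :+ con (+ 0)) :- con (+ 0) := con (+ 1) :* (a :* d :- b :* c :- con (+ 0)))
        refl (A 0F 0F) (A 0F 1F) (A 1F 0F) (A 1F 1F)))
      (solve 2 (λ b d → d :* b :+ (:- b :* d :+ con (+ 0)) := con (+ 0)) refl (A 0F 1F) (A 1F 1F))) 1F)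

    a₀₀≈0 : A 0F 0F ≈ 0#
    a₀₀≈0 = -x≈0⇒x≈0 (indep (A 1F 0F ∷ - A 0F 0F ∷ []) (entries₂
      (solve 2 (λ a c → c :* a :+ (:- a :* c :+ con (+ 0)) := con (+ 0)) refl (A 0F 0F) (A 1F 0F))
      (≈-by-multiple det≈0 (- 1#) (solve 4 (λ a b c d →
        c :* b :+ (:- a :* d :+ con (+ 0)) :- con (+ 0) := :- con (+ 1) :* (a :* d :- b :* c :- con (+ 0)))
        refl (A 0F 0F) (A 0F 1F) (A 1F 0F) (A 1F 1F)))) 1F)

  module _ {B : Matrix 2 2} (det≉0 : ¬ det B ≈ 0#) where
    private
      b₀₀ = B 0F 0F
      b₀₁ = B 0F 1F
      b₁₀ = B 1F 0F
      b₁₁ = B 1F 1F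

    -- Multiplying `v ∙ B` by the adjugate of `B` yields `det B` times `v`; the coefficients in the
    -- two entries are the columns of the adjugate.
    det≉0⇒independentRows : IndependentRows B
    det≉0⇒independentRows v vB≋0 = entries₂
      (*≈0∧≉0⇒≈0 det≉0 (≈-by-multiples (vB≋0 0F) (vB≋0 1F) b₁₁ (- b₁₀)
        (solve 6 (λ v w a b c d → (a :* d :- b :* c) :* v :- con (+ 0) :=
          d :* (v :* a :+ (w :* c :+ con (+ 0)) :- con (+ 0)) :+ :- c :* (v :* b :+ (w :* d :+ con (+ 0)) :- con (+ 0)))
          refl (v 0F) (v 1F) b₀₀ b₀₁ b₁₀ b₁₁)))
      (*≈0∧≉0⇒≈0 det≉0 (≈-by-multiples (vB≋0 0F) (vB≋0 1F) (- b₀₁) b₀₀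
        (solve 6 (λ v w a b c d → (a :* d :- b :* c) :* w :- con (+ 0) :=
          :- b :* (v :* a :+ (w :* c :+ con (+ 0)) :- con (+ 0)) :+ a :* (v :* b :+ (w :* d :+ con (+ 0)) :- con (+ 0)))
          refl (v 0F) (v 1F) b₀₀ b₀₁ b₁₀ b₁₁)))

    -- Cramer's rule: `w` times the adjugate of `B`, divided by `det B`.
    solution : Vector Carrier 2 → Vector Carrier 2
    solution w = i * (w 0F * b₁₁ - w 1F * b₁₀) ∷ i * (w 1F * b₀₀ - w 0F * b₀₁) ∷ []
      where i = recip (det B) det≉0

    solution-∙ : ∀ w → solution w ∙ B ≋ w
    solution-∙ w = entries₂
      (≈-by-multiple (recip-inverseʳ (det B) det≉0) (w 0F)
        (solve 7 (λ i v w a b c d → i :* (v :* d :- w :* c) :* a :+ (i :* (w :* a :- v :* b) :* c :+ con (+ 0)) :- v :=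
          v :* ((a :* d :- b :* c) :* i :- con (+ 1)))
          refl i (w 0F) (w 1F) b₀₀ b₀₁ b₁₀ b₁₁))
      (≈-by-multiple (recip-inverseʳ (det B) det≉0) (w 1F)
        (solve 7 (λ i v w a b c d → i :* (v :* d :- w :* c) :* b :+ (i :* (w :* a :- v :* b) :* d :+ con (+ 0)) :- w :=
          w :* ((a :* d :- b :* c) :* i :- con (+ 1)))
          refl i (w 0F) (w 1F) b₀₀ b₀₁ b₁₀ b₁₁))
      where i = recip (det B) det≉0

    det≉0⇒∙-cancel : ∀ {u v} → u ∙ B ≋ v ∙ B → u ≋ v
    det≉0⇒∙-cancel = independentRows⇒∙-cancel {A = B} det≉0⇒independentRows

-- Matrices up to scalars and the order of PGL₂

module ProjectiveMatrices {c ℓ q} (F : FiniteField c ℓ q) where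
  open FiniteField F
  open import Data.Vec.Functional using ([]; _∷_)
  open ProjectiveSpace F
  open FieldProperties F
  open MatrixProperties F
  open IntegerCoefficientSolver commutativeRing

  private
    variable
      m n : ℕ

  ≈ₘ⇒∝ : {A B : Matrix m n} → A ≈ₘ B → A ∝ B
  ≈ₘ⇒∝ A≈B = 1# , 1≉0 , λ j k → trans (A≈B j k) (sym (*-identityˡ _))

  abstract
    ∝-isEquivalence : IsEquivalence (_∝_ {m} {n})
    ∝-isEquivalence = record
      { refl  = ≈ₘ⇒∝ (λ _ _ → refl)
      ; sym   = λ {A} {B} (x , x≉0 , A≈xB) → recip x x≉0 , recip-nonZero x x≉0 , λ j k →
          sym (≈-by-multiples (A≈xB j k) (recip-inverseʳ x x≉0) (recip x x≉0) (B j k)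
            (solve 4 (λ i x a b → i :* a :- b := i :* (a :- x :* b) :+ b :* (x :* i :- con (+ 1)))
              refl (recip x x≉0) x (A j k) (B j k)))
      ; trans = λ (x , x≉0 , A≈xB) (y , y≉0 , B≈yC) → x * y , *-nonZero x≉0 y≉0 , λ j k →
          trans (A≈xB j k) (trans (*-congˡ (B≈yC j k)) (sym (*-assoc x y _)))
      }

  MatricesUpToScalars : ℕ → ℕ → Setoid c (c ⊔ ℓ)
  MatricesUpToScalars m n = record { isEquivalence = ∝-isEquivalence {m} {n} }

  PGL₂ : Setoid (c ⊔ ℓ) (c ⊔ ℓ)
  PGL₂ = SubsetOf (MatricesUpToScalars 2 2) (λ A → ¬ det A ≈ 0#)

  nonZeros : Setoid (c ⊔ ℓ) ℓ
  nonZeros = SubsetOf setoid (λ x → ¬ x ≈ 0#)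

  -- A matrix of PGL₂ is scaled so that its first nonzero entry is 1.
  normalForms : Inverse ((setoid ×ₛ (setoid ×ₛ nonZeros)) ⊎ₛ (nonZeros ×ₛ setoid)) PGL₂
  normalForms = injectiveSection⇒inverse to to-cong to-injective (λ (A , det≉0) → from A det≉0)
                  (λ (A , det≉0) → to-from A det≉0)
    where
    open Setoid ((setoid ×ₛ (setoid ×ₛ nonZeros)) ⊎ₛ (nonZeros ×ₛ setoid))
      using () renaming (Carrier to NormalForm; _≈_ to _≈ₙ_)

    to : NormalForm → Setoid.Carrier PGL₂
    -- With the last entry written as `b * c + e` the determinant is `e`, so it is parametrised by a
    -- nonzero element.
    to (inj₁ (b , c , e , e≉0)) =
      ((1# ∷ b ∷ []) ∷ (c ∷ (b * c + e) ∷ []) ∷ []) ,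
      λ det≈0 → e≉0 (trans
        (solve 3 (λ b c e → e := con (+ 1) :* (b :* c :+ e) :- b :* c) refl b c e) det≈0)
    to (inj₂ ((c , c≉0) , d)) =
      ((0# ∷ 1# ∷ []) ∷ (c ∷ d ∷ []) ∷ []) ,
      λ det≈0 → c≉0 (-x≈0⇒x≈0 (trans
        (solve 2 (λ c d → :- c := con (+ 0) :* d :- con (+ 1) :* c) refl c d) det≈0))

    to-cong : Congruent _≈ₙ_ (Setoid._≈_ PGL₂) to
    to-cong (⊎.inj₁ (b≈ , c≈ , e≈)) = ≈ₘ⇒∝ (entries₂ (entries₂ refl b≈) (entries₂ c≈ (+-cong (*-cong b≈ c≈) e≈)))
    to-cong (⊎.inj₂ (c≈ , d≈)) = ≈ₘ⇒∝ (entries₂ (entries₂ refl refl) (entries₂ c≈ d≈))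

    1≈x*1⇒x*y≈y : ∀ {x} y → 1# ≈ x * 1# → x * y ≈ y
    1≈x*1⇒x*y≈y y 1≈x = trans (*-congʳ (sym (trans 1≈x (*-identityʳ _)))) (*-identityˡ y)

    to-injective : Injective _≈ₙ_ (Setoid._≈_ PGL₂) to
    to-injective {inj₁ (b , c , e , _)} {inj₁ (b′ , c′ , e′ , _)} (x , _ , A≈xB) =
      ⊎.inj₁ (entry (A≈xB 0F 1F) , entry (A≈xB 1F 0F) ,
        ≈-by-multiples (entry (A≈xB 1F 1F)) (*-cong (entry (A≈xB 0F 1F)) (entry (A≈xB 1F 0F))) 1# (- 1#)
          (solve 4 (λ e e′ p p′ → e :- e′ := con (+ 1) :* (p :+ e :- (p′ :+ e′)) :+ :- con (+ 1) :* (p :- p′))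
            refl e e′ (b * c) (b′ * c′)))
      where
      entry : ∀ {y z} → y ≈ x * z → y ≈ z
      entry y≈xz = trans y≈xz (1≈x*1⇒x*y≈y _ (A≈xB 0F 0F))
    to-injective {inj₁ _} {inj₂ _} (x , _ , A≈xB) = contradiction (trans (A≈xB 0F 0F) (zeroʳ x)) 1≉0
    to-injective {inj₂ _} {inj₁ _} (x , x≉0 , A≈xB) =
      contradiction (trans (sym (*-identityʳ x)) (sym (A≈xB 0F 0F))) x≉0
    to-injective {inj₂ _} {inj₂ _} (x , _ , A≈xB) = ⊎.inj₂ (entry (A≈xB 1F 0F) , entry (A≈xB 1F 1F))
      where
      entry : ∀ {y z} → y ≈ x * z → y ≈ z
      entry y≈xz = trans y≈xz (1≈x*1⇒x*y≈y _ (A≈xB 0F 1F))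

    bc≉0 : ∀ A → ¬ det A ≈ 0# → A 0F 0F ≈ 0# → ¬ A 0F 1F * A 1F 0F ≈ 0#
    bc≉0 A det≉0 a≈0 bc≈0 = det≉0 (≈-by-multiples a≈0 bc≈0 (A 1F 1F) (- 1#)
      (solve 3 (λ a d p → a :* d :- p :- con (+ 0) := d :* (a :- con (+ 0)) :+ :- con (+ 1) :* (p :- con (+ 0)))
        refl (A 0F 0F) (A 1F 1F) (A 0F 1F * A 1F 0F)))

    from : ∀ A → ¬ det A ≈ 0# → NormalForm
    from A det≉0 with A 0F 0F ≟ 0#
    -- Scaling by `r` = 1/a multiplies the determinant by `r * r`, and the third parameter is the
    -- determinant of the scaled matrix.
    ... | no a≉0  = inj₁ (r * A 0F 1F , r * A 1F 0F , r * r * det A ,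
                         *-nonZero (*-nonZero (recip-nonZero _ a≉0) (recip-nonZero _ a≉0)) det≉0)
      where r = recip (A 0F 0F) a≉0
    ... | yes a≈0 = inj₂ ((r * A 1F 0F , *-nonZero (recip-nonZero _ b≉0) (*-nonZeroʳ (bc≉0 A det≉0 a≈0))) , r * A 1F 1F)
      where
      b≉0 = *-nonZeroˡ (bc≉0 A det≉0 a≈0)
      r   = recip (A 0F 1F) b≉0

    to-from : ∀ A det≉0 → proj₁ (to (from A det≉0)) ∝ A
    to-from A det≉0 with A 0F 0F ≟ 0#
    ... | no a≉0  = r , recip-nonZero _ a≉0 , entries₂
      (entries₂ (trans (sym (recip-inverseʳ _ a≉0)) (*-comm _ r)) refl)
      (entries₂ refl (≈-by-multiple (recip-inverseʳ _ a≉0) (r * A 1F 1F)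
        (solve 5 (λ r a b c d → r :* b :* (r :* c) :+ r :* r :* (a :* d :- b :* c) :- r :* d :=
          r :* d :* (a :* r :- con (+ 1))) refl r (A 0F 0F) (A 0F 1F) (A 1F 0F) (A 1F 1F))))
      where r = recip (A 0F 0F) a≉0
    ... | yes a≈0 = r , recip-nonZero _ b≉0 , entries₂
      (entries₂ (sym (x≈0⇒y*x≈0 r a≈0)) (trans (sym (recip-inverseʳ _ b≉0)) (*-comm _ r)))
      (entries₂ refl refl)
      where
      b≉0 = *-nonZeroˡ (bc≉0 A det≉0 a≈0)
      r   = recip (A 0F 1F) b≉0

  PGL₂-size : HasSize PGL₂ (q ℕ.* (q ℕ.* (q ∸ 1)) ℕ.+ (q ∸ 1) ℕ.* q)
  PGL₂-size = ↔-trans (↔-sym normalForms)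
    (HasSize-⊎ (HasSize-× size (HasSize-× size q-1)) (HasSize-× q-1 size))
    where
    q-1 : HasSize nonZeros (q ∸ 1)
    q-1 = Exactly-remove size 0#

  Matrices₂ : Setoid c ℓ
  Matrices₂ = record
    { Carrier       = Matrix 2 2
    ; _≈_           = _≈ₘ_
    ; isEquivalence = record
      { refl  = λ _ _ → refl
      ; sym   = λ A≈B j k → sym (A≈B j k)
      ; trans = λ A≈B B≈C j k → trans (A≈B j k) (B≈C j k)
      }
    }

  Matrices₂-size : HasSize Matrices₂ (q ℕ.* q ℕ.* (q ℕ.* q))
  Matrices₂-size = ↔-trans entries (HasSize-× (HasSize-× size size) (HasSize-× size size))
    where
    entries : Inverse Matrices₂ ((setoid ×ₛ setoid) ×ₛ (setoid ×ₛ setoid))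
    entries = injectiveSection⇒inverse
      (λ A → (A 0F 0F , A 0F 1F) , (A 1F 0F , A 1F 1F))
      (λ A≈B → (A≈B 0F 0F , A≈B 0F 1F) , (A≈B 1F 0F , A≈B 1F 1F))
      (λ ((a≈ , b≈) , (c≈ , d≈)) → entries₂ (entries₂ a≈ b≈) (entries₂ c≈ d≈))
      (λ ((a , b) , (c , d)) → (a ∷ b ∷ []) ∷ (c ∷ d ∷ []) ∷ [])
      (λ _ → (refl , refl) , (refl , refl))

≢⇒2≤ : ∀ {n} {j k : Fin n} → j ≢ k → 2 ℕ.≤ n
≢⇒2≤ {1}           {0F} {0F} 0≢0 = contradiction ≡.refl 0≢0
≢⇒2≤ {suc (suc _)} {_}  {_}  _   = ℕ.s≤s (ℕ.s≤s ℕ.z≤n)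

-- With q = 1 + m both subtractions of 1 from q and q² compute away, and a semiring identity in m
-- remains. The bound on q makes q(q² - 1) positive, so that the final `∸ 1 ℕ.+ 1` cancels.
PGL₂-order : ∀ {q} → 2 ℕ.≤ q → q ℕ.* (q ℕ.* (q ∸ 1)) ℕ.+ (q ∸ 1) ℕ.* q ≡ q ℕ.* (q ℕ.^ 2 ∸ 1) ∸ 1 ℕ.+ 1
PGL₂-order {suc (suc n)} _ = ≡.trans
  (solve 1 (λ m → (con 1 :+ m) :* ((con 1 :+ m) :* m) :+ m :* (con 1 :+ m) :=
                  (con 1 :+ m) :* (m :* con 1 :+ m :* ((con 1 :+ m) :* con 1))) ≡.refl (suc n))
  (≡.sym (ℕ.m∸n+n≡m (ℕ.s≤s ℕ.z≤n)))
  where open +-*-Solver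
PGL₂-order {1} (ℕ.s≤s ())

-- The geometry in coordinates

-- The line (N I₂) is represented by N and the quadric (0 B; Bᵀ C) by the pair of B and C.
module Coordinates {c ℓ q} (F : FiniteField c ℓ q) where
  open FiniteField F
  open import Data.Vec.Functional using ([]; _∷_; _++_)
  open ProjectiveSpace F
  open FieldProperties F
  open MatrixProperties F
  open ProjectiveMatrices F
  open IntegerCoefficientSolver commutativeRing
  open import Algebra.Properties.Group +-group
    using () renaming (x≈y⇒x∙y⁻¹≈ε to x≈y⇒x-y≈0; x∙y⁻¹≈ε⇒x≈y to x-y≈0⇒x≈y)
  open import Relation.Binary.Reasoning.Setoid setoid

  record QuadricMatrix : Set (c ⊔ ℓ) where
    field
      B           : Matrix 2 2
      C           : Matrix 2 2
      det≉0       : ¬ det B ≈ 0#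
      C-symmetric : ∀ j k → C j k ≈ C k j

    -- Stacking makes `_∝_` demand one common scalar for `B` and `C`.
    blocks : Matrix 4 2
    blocks = B ++ C

  open QuadricMatrix

  QuadricMatrices : Setoid (c ⊔ ℓ) (c ⊔ ℓ)
  QuadricMatrices = record
    { Carrier       = QuadricMatrix
    ; _≈_           = λ Q R → blocks Q ∝ blocks R
    ; isEquivalence = record
      { refl  = IsEquivalence.refl ∝-isEquivalence
      ; sym   = IsEquivalence.sym ∝-isEquivalence
      ; trans = IsEquivalence.trans ∝-isEquivalence
      }
    }

  module _ {Q R : QuadricMatrix} where

    ∝-blocks : ∀ {x} → ¬ x ≈ 0# →
               (∀ j k → B Q j k ≈ x * B R j k) → (∀ j k → C Q j k ≈ x * C R j k) → blocks Q ∝ blocks R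
    ∝-blocks {x} x≉0 B≈ C≈ = x , x≉0 , entries₄ (B≈ 0F) (B≈ 1F) (C≈ 0F) (C≈ 1F)

    ∝-B : ((x , _) : blocks Q ∝ blocks R) → ∀ j k → B Q j k ≈ x * B R j k
    ∝-B (_ , _ , Q≈xR) = entries₂ (Q≈xR 0F) (Q≈xR 1F)

    ∝-C : ((x , _) : blocks Q ∝ blocks R) → ∀ j k → C Q j k ≈ x * C R j k
    ∝-C (_ , _ , Q≈xR) = entries₂ (Q≈xR 2F) (Q≈xR 3F)

  symmetrization : Matrix 2 2 → Matrix 2 2
  symmetrization A j k = A j k + A k j

  skew : Matrix 2 2 → Carrier
  skew A = A 0F 1F - A 1F 0F

  -- This is T of the overview, and it equals L G Lᵀ for L = (N I₂) and G = (0 B; Bᵀ C).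
  defect : Matrix 2 2 → QuadricMatrix → Matrix 2 2
  defect N Q j k = symmetrization (N · B Q) j k + C Q j k

  infix 4 _∈_
  _∈_ : Matrix 2 2 → QuadricMatrix → Set ℓ
  N ∈ Q = defect N Q ≈ₘ 0ₘ

  coordinateStructure : IncidenceStructure c ℓ (c ⊔ ℓ) (c ⊔ ℓ) ℓ
  coordinateStructure = record { Points = Matrices₂ ; Blocks = QuadricMatrices ; _∈_ = _∈_ }

  open IncidenceStructure coordinateStructure using (_≈ᵦ_; Joined; JoinedPointsOf; Points; Blocks)

  ·-congˡ : ∀ {N M : Matrix 2 2} (A : Matrix 2 2) → N ≈ₘ M → N · A ≈ₘ M · A
  ·-congˡ A N≈M j = ∙-congʳ A (N≈M j)

  defect-cong : ∀ {N M} Q → N ≈ₘ M → defect N Q ≈ₘ defect M Q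
  defect-cong {N} {M} Q N≈M j k = +-congʳ (+-cong (·-congˡ {N} {M} (B Q) N≈M j k) (·-congˡ {N} {M} (B Q) N≈M k j))

  ∈-resp-≈ₘ : ∀ {N M} Q → N ≈ₘ M → N ∈ Q → M ∈ Q
  ∈-resp-≈ₘ {N} {M} Q N≈M N∈Q j k = trans (sym (defect-cong {N} {M} Q N≈M j k)) (N∈Q j k)

  ·-scale : ∀ (N : Matrix 2 2) {A A′ : Matrix 2 2} {x} → (∀ j k → A j k ≈ x * A′ j k) →
            ∀ j k → (N · A) j k ≈ x * (N · A′) j k
  ·-scale N {A} {A′} A≈xA′ j = ∙-scale (N j) {A} {A′} A≈xA′

  ∈-resp-≈ᵦ : ∀ {N Q R} → Q ≈ᵦ R → N ∈ R → N ∈ Q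
  ∈-resp-≈ᵦ {N} {Q} {R} Q≈R@(x , _ , _) N∈R j k = begin
    (N · B Q) j k + (N · B Q) k j + C Q j k
      ≈⟨ +-cong (+-cong (·-scale N B≈ j k) (·-scale N B≈ k j)) (∝-C {Q} {R} Q≈R j k) ⟩
    x * (N · B R) j k + x * (N · B R) k j + x * C R j k
      ≈⟨ solve 4 (λ x a b c → x :* a :+ x :* b :+ x :* c := x :* (a :+ b :+ c)) refl
          x ((N · B R) j k) ((N · B R) k j) (C R j k) ⟩
    x * defect N R j k
      ≈⟨ x≈0⇒y*x≈0 x (N∈R j k) ⟩
    0# ∎
    where
    B≈ : ∀ j k → B Q j k ≈ x * B R j k
    B≈ = ∝-B {Q} {R} Q≈R

  infixl 6 _-ₘ_
  _-ₘ_ : Matrix 2 2 → Matrix 2 2 → Matrix 2 2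
  (N -ₘ M) j = N j -ᵥ M j

  -ₘ-· : ∀ N M (A : Matrix 2 2) j k → ((N -ₘ M) · A) j k ≈ (N · A) j k - (M · A) j k
  -ₘ-· N M A j k = -ᵥ-∙ (N j) (M j) A k

  symmetrization-difference : ∀ N M A j k → symmetrization ((N -ₘ M) · A) j k ≈
                              symmetrization (N · A) j k - symmetrization (M · A) j k
  symmetrization-difference N M A j k = trans (+-cong (-ₘ-· N M A j k) (-ₘ-· N M A k j))
    (solve 4 (λ a b c d → a :- b :+ (c :- d) := a :+ c :- (b :+ d)) refl
      ((N · A) j k) ((M · A) j k) ((N · A) k j) ((M · A) k j))

  skew-difference : ∀ N M A → skew ((N -ₘ M) · A) ≈ skew (N · A) - skew (M · A)
  skew-difference N M A = trans (+-cong (-ₘ-· N M A 0F 1F) (-‿cong (-ₘ-· N M A 1F 0F)))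
    (solve 4 (λ a b c d → a :- b :- (c :- d) := a :- c :- (b :- d)) refl
      ((N · A) 0F 1F) ((M · A) 0F 1F) ((N · A) 1F 0F) ((M · A) 1F 0F))

  skew-cong : ∀ {A A′} → A ≈ₘ A′ → skew A ≈ skew A′
  skew-cong A≈A′ = +-cong (A≈A′ 0F 1F) (-‿cong (A≈A′ 1F 0F))

  det-cong : ∀ {A A′} → A ≈ₘ A′ → det A ≈ det A′
  det-cong A≈A′ = +-cong (*-cong (A≈A′ 0F 0F) (A≈A′ 1F 1F)) (-‿cong (*-cong (A≈A′ 0F 1F) (A≈A′ 1F 0F)))

  -- Membership of `M` says that `C Q` is minus the symmetrization of `M · B Q`. Hence the choice of
  -- `M` on the block does not affect the left side.
  symmetrization≈defect : ∀ {M Q} N → M ∈ Q → symmetrization ((N -ₘ M) · B Q) ≈ₘ defect N Q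
  symmetrization≈defect {M} {Q} N M∈Q j k = trans (symmetrization-difference N M (B Q) j k)
    (≈-by-multiple (M∈Q j k) (- 1#)
      (solve 3 (λ n m c → n :- m :- (n :+ c) := :- con (+ 1) :* (m :+ c :- con (+ 0))) refl
        (symmetrization (N · B Q) j k) (symmetrization (M · B Q) j k) (C Q j k)))

  -- Twice `A` is `symmetrization A` plus `skew A` times J, and the mixed terms cancel in the
  -- determinant of this sum.
  4det : ∀ A → (1# + 1#) * (1# + 1#) * det A ≈ det (symmetrization A) + skew A * skew A
  4det A = solve 4 (λ a b c d →
    (con (+ 1) :+ con (+ 1)) :* (con (+ 1) :+ con (+ 1)) :* (a :* d :- b :* c) :=
    (a :+ a) :* (d :+ d) :- (b :+ c) :* (c :+ b) :+ (b :- c) :* (b :- c)) refl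
    (A 0F 0F) (A 0F 1F) (A 1F 0F) (A 1F 1F)

  discriminant : ∀ {M Q} N → M ∈ Q → (1# + 1#) * (1# + 1#) * (det (N -ₘ M) * det (B Q)) ≈
                 det (defect N Q) + skew ((N -ₘ M) · B Q) * skew ((N -ₘ M) · B Q)
  discriminant {M} {Q} N M∈Q = begin
    (1# + 1#) * (1# + 1#) * (det (N -ₘ M) * det (B Q))    ≈⟨ *-congˡ (det-· (N -ₘ M) (B Q)) ⟨
    (1# + 1#) * (1# + 1#) * det X                         ≈⟨ 4det X ⟩
    det (symmetrization X) + skew X * skew X              ≈⟨ +-congʳ (det-cong (symmetrization≈defect {M} {Q} N M∈Q)) ⟩
    det (defect N Q) + skew X * skew X                    ∎
    where
    X : Matrix 2 2
    X = (N -ₘ M) · B Q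

  det-zero : ∀ {A} → A ≈ₘ 0ₘ → det A ≈ 0#
  det-zero A≈0 = trans (det-cong A≈0)
    (solve 0 (con (+ 0) :* con (+ 0) :- con (+ 0) :* con (+ 0) := con (+ 0)) refl)

  throughPoint : Matrix 2 2 → (A : Matrix 2 2) → ¬ det A ≈ 0# → QuadricMatrix
  throughPoint N A det≉0 = record
    { B           = A
    ; C           = λ j k → - symmetrization (N · A) j k
    ; det≉0       = det≉0
    ; C-symmetric = λ j k → -‿cong (+-comm _ _)
    }

  ∈-throughPoint-self : ∀ N A d → N ∈ throughPoint N A d
  ∈-throughPoint-self N A d j k = -‿inverseʳ _

  ∈-throughPoint : ∀ N M A d → symmetrization ((N -ₘ M) · A) ≈ₘ 0ₘ → M ∈ throughPoint N A d
  ∈-throughPoint N M A d alternating j k =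
    ≈-by-multiple (trans (sym (symmetrization-difference N M A j k)) (alternating j k)) (- 1#)
      (solve 2 (λ n m → m :- n :- con (+ 0) := :- con (+ 1) :* (n :- m :- con (+ 0))) refl
        (symmetrization (N · A) j k) (symmetrization (M · A) j k))

  -- Membership of `N` expresses `C` linearly through `N · B`, so the scalar between the `B`s also
  -- relates the `C`s.
  ∈∈∝⇒≈ᵦ : ∀ {N Q R} → N ∈ Q → N ∈ R → B Q ∝ B R → Q ≈ᵦ R
  ∈∈∝⇒≈ᵦ {N} {Q} {R} N∈Q N∈R (x , x≉0 , B≈) = ∝-blocks {Q} {R} x≉0 B≈ λ j k →
    ≈-by-multiples
      (trans (sym (+-congʳ (+-cong (·-scale N B≈ j k) (·-scale N B≈ k j)))) (N∈Q j k)) (N∈R j k) 1# (- x)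
      (solve 5 (λ x a b c c′ → c :- x :* c′ :=
        con (+ 1) :* (x :* a :+ x :* b :+ c :- con (+ 0)) :+ :- x :* (a :+ b :+ c′ :- con (+ 0))) refl
        x ((N · B R) j k) ((N · B R) k j) (C Q j k) (C R j k))

  blocks-per-point : ∀ N → Inverse (SubsetOf Blocks (N ∈_)) PGL₂
  blocks-per-point N = injectiveSection⇒inverse
    (λ (Q , _) → B Q , det≉0 Q)
    (λ {(Q , _)} {(R , _)} Q≈R@(x , x≉0 , _) → x , x≉0 , ∝-B {Q} {R} Q≈R)
    (λ {(Q , N∈Q)} {(R , N∈R)} → ∈∈∝⇒≈ᵦ {N} {Q} {R} N∈Q N∈R)
    (λ (A , d) → throughPoint N A d , ∈-throughPoint-self N A d)
    (λ _ → IsEquivalence.refl ∝-isEquivalence)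

  -- adj K · J, where J is the alternating matrix with J₀₁ = 1, so that K · pencil K = det K · J.
  pencil : Matrix 2 2 → Matrix 2 2
  pencil K = (K 0F 1F ∷ K 1F 1F ∷ []) ∷ (- K 0F 0F ∷ - K 1F 0F ∷ []) ∷ []

  det-pencil : ∀ K → det (pencil K) ≈ det K
  det-pencil K = solve 4 (λ a b c d → b :* :- c :- d :* :- a := a :* d :- b :* c) refl
    (K 0F 0F) (K 0F 1F) (K 1F 0F) (K 1F 1F)

  pencil-alternating : ∀ K → symmetrization (K · pencil K) ≈ₘ 0ₘ
  pencil-alternating K = entries₂ (entries₂ (diagonal (K 0F 0F) (K 0F 1F)) off-diagonal)
                                  (entries₂ (trans (+-comm _ _) off-diagonal) (diagonal (K 1F 0F) (K 1F 1F)))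
    where
    diagonal = solve 2 (λ a b →
      a :* b :+ (b :* :- a :+ con (+ 0)) :+ (a :* b :+ (b :* :- a :+ con (+ 0))) := con (+ 0)) refl
    off-diagonal = solve 4 (λ a b c d →
      a :* d :+ (b :* :- c :+ con (+ 0)) :+ (c :* b :+ (d :* :- a :+ con (+ 0))) := con (+ 0)) refl
      (K 0F 0F) (K 0F 1F) (K 1F 0F) (K 1F 1F)

  -- Points of a block, joined points and the axioms in odd characteristic

  module _ (2≉0 : ¬ 1# + 1# ≈ 0#) where

    open OddCharacteristic 2≉0

    symmetrization≈0∧skew≈0⇒≈0 : ∀ {A} → symmetrization A ≈ₘ 0ₘ → skew A ≈ 0# → A ≈ₘ 0ₘ
    symmetrization≈0∧skew≈0⇒≈0 {A} sym≈0 skew≈0 = entries₂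
      (entries₂ (x+x≈0⇒x≈0 (sym≈0 0F 0F)) (x+x≈0⇒x≈0 (≈-by-multiples (sym≈0 0F 1F) skew≈0 1# 1#
        (solve 2 (λ b c → b :+ b :- con (+ 0) :=
          con (+ 1) :* (b :+ c :- con (+ 0)) :+ con (+ 1) :* (b :- c :- con (+ 0))) refl (A 0F 1F) (A 1F 0F)))))
      (entries₂ (x+x≈0⇒x≈0 (≈-by-multiples (sym≈0 0F 1F) skew≈0 1# (- 1#)
        (solve 2 (λ b c → c :+ c :- con (+ 0) :=
          con (+ 1) :* (b :+ c :- con (+ 0)) :+ :- con (+ 1) :* (b :- c :- con (+ 0))) refl (A 0F 1F) (A 1F 0F))))
        (x+x≈0⇒x≈0 (sym≈0 1F 1F)))

    -- For two points of the block the symmetrization of `(N -ₘ M) · B Q` is zero. If the skew part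
    -- is zero too, the product is zero, and the invertible `B Q` cancels.
    ∈∈skew≈0⇒≈ₘ : ∀ {N M Q} → N ∈ Q → M ∈ Q → skew ((N -ₘ M) · B Q) ≈ 0# → N ≈ₘ M
    ∈∈skew≈0⇒≈ₘ {N} {M} {Q} N∈Q M∈Q skew≈0 j k = x-y≈0⇒x≈y (N j k) (M j k)
      (det≉0⇒independentRows {B Q} (det≉0 Q) ((N -ₘ M) j)
        (symmetrization≈0∧skew≈0⇒≈0 {(N -ₘ M) · B Q}
          (λ j k → trans (symmetrization≈defect {M} {Q} N M∈Q j k) (N∈Q j k)) skew≈0 j) k)

    skew-injective : ∀ {N M Q} → N ∈ Q → M ∈ Q → skew (N · B Q) ≈ skew (M · B Q) → N ≈ₘ M
    skew-injective {N} {M} {Q} N∈Q M∈Q eq = ∈∈skew≈0⇒≈ₘ {N} {M} {Q} N∈Q M∈Q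
      (trans (skew-difference N M (B Q)) (x≈y⇒x-y≈0 eq))

    points-of-block : ∀ Q → Inverse (SubsetOf Points (_∈ Q)) setoid
    points-of-block Q = injectiveSection⇒inverse
      (λ (N , _) → skew (N · B Q))
      (λ {(N , _)} {(M , _)} N≈M → skew-cong {N · B Q} {M · B Q} (·-congˡ {N} {M} (B Q) N≈M))
      (λ {(N , N∈Q)} {(M , M∈Q)} → skew-injective {N} {M} {Q} N∈Q M∈Q)
      (λ x → point x , point-∈ x)
      (λ x → trans (skew-cong {point x · B Q} {value x} (point-· x)) (skew-value x))
      where
      -- The matrix with symmetrization `- C Q` and skew part `x`, which `N · B Q` has to be for the
      -- point `N` with coordinate `x`.
      value : Carrier → Matrix 2 2
      value x = (½ * - C Q 0F 0F ∷ ½ * (x - C Q 0F 1F) ∷ []) ∷ (½ * (- x - C Q 0F 1F) ∷ ½ * - C Q 1F 1F ∷ []) ∷ []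

      point : Carrier → Matrix 2 2
      point x j = solution {B Q} (det≉0 Q) (value x j)

      point-· : ∀ x → point x · B Q ≈ₘ value x
      point-· x j = solution-∙ {B Q} (det≉0 Q) (value x j)

      skew-value : ∀ x → skew (value x) ≈ x
      skew-value x = ≈-by-multiple 2*½≈1 x
        (solve 3 (λ h x c → h :* (x :- c) :- h :* (:- x :- c) :- x := x :* ((con (+ 1) :+ con (+ 1)) :* h :- con (+ 1)))
          refl ½ x (C Q 0F 1F))

      value-∈ : ∀ x j k → value x j k + value x k j + C Q j k ≈ 0#
      value-∈ x = entries₂ (entries₂ (diagonal (C Q 0F 0F)) off-diagonal)
        (entries₂ (trans (+-cong (+-comm _ _) (C-symmetric Q 1F 0F)) off-diagonal) (diagonal (C Q 1F 1F)))
        where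
        diagonal : ∀ c → ½ * - c + ½ * - c + c ≈ 0#
        diagonal c = ≈-by-multiple 2*½≈1 (- c)
          (solve 2 (λ h c → h :* :- c :+ h :* :- c :+ c :- con (+ 0) :=
            :- c :* ((con (+ 1) :+ con (+ 1)) :* h :- con (+ 1))) refl ½ c)

        off-diagonal : ½ * (x - C Q 0F 1F) + ½ * (- x - C Q 0F 1F) + C Q 0F 1F ≈ 0#
        off-diagonal = ≈-by-multiple 2*½≈1 (- C Q 0F 1F)
          (solve 3 (λ h x c → h :* (x :- c) :+ h :* (:- x :- c) :+ c :- con (+ 0) :=
            :- c :* ((con (+ 1) :+ con (+ 1)) :* h :- con (+ 1))) refl ½ x (C Q 0F 1F))

      point-∈ : ∀ x → point x ∈ Q
      point-∈ x j k = trans (+-congʳ (+-cong (point-· x j k) (point-· x k j))) (value-∈ x j k)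

    -- With `N` on the block as well, `discriminant` reads 4 det (N - M) det B = s². A zero
    -- determinant would force s = 0 and so `N ≈ₘ M`.
    collinear⇒det≉0 : ∀ {N M Q} → ¬ N ≈ₘ M → N ∈ Q → M ∈ Q → ¬ det (N -ₘ M) ≈ 0#
    collinear⇒det≉0 {N} {M} {Q} N≉M N∈Q M∈Q det≈0 = N≉M (∈∈skew≈0⇒≈ₘ {N} {M} {Q} N∈Q M∈Q
      (square≈0⇒≈0 (begin
        s * s                                                 ≈⟨ +-identityˡ _ ⟨
        0# + s * s                                            ≈⟨ +-congʳ (det-zero {defect N Q} N∈Q) ⟨
        det (defect N Q) + s * s                              ≈⟨ discriminant {M} {Q} N M∈Q ⟨
        (1# + 1#) * (1# + 1#) * (det (N -ₘ M) * det (B Q))    ≈⟨ x≈0⇒y*x≈0 _ (trans (*-congʳ det≈0) (zeroˡ _)) ⟩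
        0#                                                    ∎)))
      where
      s = skew ((N -ₘ M) · B Q)

    det≉0⇒joined : ∀ {N M} → ¬ det (N -ₘ M) ≈ 0# → Joined N M
    det≉0⇒joined {N} {M} det≉0 =
      throughPoint N A d , ∈-throughPoint-self N A d , ∈-throughPoint N M A d (pencil-alternating (N -ₘ M))
      where
      A = pencil (N -ₘ M)
      d = λ eq → det≉0 (trans (sym (det-pencil (N -ₘ M))) eq)

    -- The alternating `K · A` is μJ. Multiplying it by the adjugate of `K` on the left gives det K
    -- · A = μ · `pencil K`; the coefficients in `scaled` are entries of that adjugate.
    alternating⇒∝-pencil : ∀ {K A} → ¬ det K ≈ 0# → ¬ det A ≈ 0# → symmetrization (K · A) ≈ₘ 0ₘ → A ∝ pencil K
    alternating⇒∝-pencil {K} {A} K≉0 A≉0 alternating =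
      recip (det K) K≉0 * μ , *-nonZero (recip-nonZero _ K≉0) μ≉0 , λ j k → begin
        A j k                          ≈⟨ unscale (A j k) ⟩
        i * (det K * A j k)            ≈⟨ *-congˡ (scaled j k) ⟩
        i * (μ * pencil K j k)         ≈⟨ *-assoc _ _ _ ⟨
        i * μ * pencil K j k           ∎
      where
      X : Matrix 2 2
      X = K · A
      i = recip (det K) K≉0
      μ = X 0F 1F

      unscale : ∀ a → a ≈ i * (det K * a)
      unscale a = ≈-by-multiple (recip-inverseʳ _ K≉0) (- a)
        (solve 3 (λ i d a → a :- i :* (d :* a) := :- a :* (d :* i :- con (+ 1))) refl i (det K) a)

      X₀₀≈0 : X 0F 0F ≈ 0#
      X₀₀≈0 = x+x≈0⇒x≈0 (alternating 0F 0F)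

      X₁₁≈0 : X 1F 1F ≈ 0#
      X₁₁≈0 = x+x≈0⇒x≈0 (alternating 1F 1F)

      μ≉0 : ¬ μ ≈ 0#
      μ≉0 μ≈0 = *-nonZero K≉0 A≉0 (trans (sym (det-· K A)) (≈-by-multiples X₀₀≈0 μ≈0 (X 1F 1F) (- X 1F 0F)
        (solve 4 (λ a b c d → a :* d :- b :* c :- con (+ 0) := d :* (a :- con (+ 0)) :+ :- c :* (b :- con (+ 0)))
          refl (X 0F 0F) (X 0F 1F) (X 1F 0F) (X 1F 1F))))

      scaled : ∀ j k → det K * A j k ≈ μ * pencil K j k
      scaled = entries₂
        (entries₂
          (≈-by-multiples X₀₀≈0 (alternating 0F 1F) (K 1F 1F) (- K 0F 1F) (solve 8 (λ a b c d e f g h →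
            (a :* d :- b :* c) :* e :- (a :* f :+ (b :* h :+ con (+ 0))) :* b :=
            d :* (a :* e :+ (b :* g :+ con (+ 0)) :- con (+ 0)) :+
            :- b :* ((a :* f :+ (b :* h :+ con (+ 0))) :+ (c :* e :+ (d :* g :+ con (+ 0))) :- con (+ 0))) refl
            (K 0F 0F) (K 0F 1F) (K 1F 0F) (K 1F 1F) (A 0F 0F) (A 0F 1F) (A 1F 0F) (A 1F 1F)))
          (≈-by-multiple X₁₁≈0 (- K 0F 1F) (solve 6 (λ a b c d f h →
            (a :* d :- b :* c) :* f :- (a :* f :+ (b :* h :+ con (+ 0))) :* d :=
            :- b :* (c :* f :+ (d :* h :+ con (+ 0)) :- con (+ 0))) refl
            (K 0F 0F) (K 0F 1F) (K 1F 0F) (K 1F 1F) (A 0F 1F) (A 1F 1F))))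
        (entries₂
          (≈-by-multiples X₀₀≈0 (alternating 0F 1F) (- K 1F 0F) (K 0F 0F) (solve 8 (λ a b c d e f g h →
            (a :* d :- b :* c) :* g :- (a :* f :+ (b :* h :+ con (+ 0))) :* :- a :=
            :- c :* (a :* e :+ (b :* g :+ con (+ 0)) :- con (+ 0)) :+
            a :* ((a :* f :+ (b :* h :+ con (+ 0))) :+ (c :* e :+ (d :* g :+ con (+ 0))) :- con (+ 0))) refl
            (K 0F 0F) (K 0F 1F) (K 1F 0F) (K 1F 1F) (A 0F 0F) (A 0F 1F) (A 1F 0F) (A 1F 1F)))
          (≈-by-multiple X₁₁≈0 (K 0F 0F) (solve 6 (λ a b c d f h →
            (a :* d :- b :* c) :* h :- (a :* f :+ (b :* h :+ con (+ 0))) :* :- c :=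
            a :* (c :* f :+ (d :* h :+ con (+ 0)) :- con (+ 0))) refl
            (K 0F 0F) (K 0F 1F) (K 1F 0F) (K 1F 1F) (A 0F 1F) (A 1F 1F))))

    ∈∈⇒∝-pencil : ∀ {N M Q} → ¬ N ≈ₘ M → N ∈ Q → M ∈ Q → B Q ∝ pencil (N -ₘ M)
    ∈∈⇒∝-pencil {N} {M} {Q} N≉M N∈Q M∈Q = alternating⇒∝-pencil {N -ₘ M} {B Q}
      (collinear⇒det≉0 {N} {M} {Q} N≉M N∈Q M∈Q) (det≉0 Q)
      (λ j k → trans (symmetrization≈defect {M} {Q} N M∈Q j k) (N∈Q j k))

    -- Both `B Q` and `B R` are proportional to `pencil (N -ₘ M)`, hence to each other, and the
    -- common point `N` settles the `C`s.
    common-block : ∀ {N M} → ¬ N ≈ₘ M → ∀ {Q R} → N ∈ Q → M ∈ Q → N ∈ R → M ∈ R → Q ≈ᵦ R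
    common-block {N} {M} N≉M {Q} {R} N∈Q M∈Q N∈R M∈R = ∈∈∝⇒≈ᵦ {N} {Q} {R} N∈Q N∈R
      (IsEquivalence.trans ∝-isEquivalence {B Q} {pencil (N -ₘ M)} {B R}
        (∈∈⇒∝-pencil {N} {M} {Q} N≉M N∈Q M∈Q)
        (IsEquivalence.sym ∝-isEquivalence {B R} {pencil (N -ₘ M)} (∈∈⇒∝-pencil {N} {M} {R} N≉M N∈R M∈R)))

    joined-points : ∀ N Q → ¬ N ∈ Q →
                    Inverse (SubsetOf Points (λ M → M ∈ Q × Joined N M))
                            (SubsetOf setoid (λ z → ¬ z * z ≈ - det (defect N Q)))
    joined-points N Q N∉Q = ↔-trans SubsetOf-× (restrict difference to-≉ from-joined)
      where
      -- Applied to `skew (N · B Q)`, it turns the coordinate of a point `M` of the block into z of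
      -- the overview, which therefore also runs through the whole field once.
      reflection : ∀ x → Inverse setoid setoid
      reflection x = injectiveSection⇒inverse (λ y → x - y) (λ y≈z → +-congˡ (-‿cong y≈z))
        (λ {y} {z} eq → ≈-by-multiple eq (- 1#)
          (solve 3 (λ x y z → y :- z := :- con (+ 1) :* (x :- y :- (x :- z))) refl x y z))
        (λ y → x - y) (λ y → solve 2 (λ x y → x :- (x :- y) := y) refl x y)

      difference : Inverse (SubsetOf Points (_∈ Q)) setoid
      difference = ↔-trans (points-of-block Q) (reflection (skew (N · B Q)))

      4detdet : ∀ M → M ∈ Q → (1# + 1#) * (1# + 1#) * (det (N -ₘ M) * det (B Q)) ≈
                det (defect N Q) + (skew (N · B Q) - skew (M · B Q)) * (skew (N · B Q) - skew (M · B Q))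
      4detdet M M∈Q = trans (discriminant {M} {Q} N M∈Q)
        (+-congˡ (*-cong (skew-difference N M (B Q)) (skew-difference N M (B Q))))

      to-≉ : ∀ ((M , M∈Q) : Setoid.Carrier (SubsetOf Points (_∈ Q))) → Joined N M →
             ¬ Inverse.to difference (M , M∈Q) * Inverse.to difference (M , M∈Q) ≈ - det (defect N Q)
      to-≉ (M , M∈Q) (R , N∈R , M∈R) z²≈-det = *-nonZero 4≉0
        (*-nonZero (collinear⇒det≉0 {N} {M} {R} N≉M N∈R M∈R) (det≉0 Q))
        (trans (4detdet M M∈Q) (trans (+-congˡ z²≈-det) (-‿inverseʳ _)))
        where
        N≉M : ¬ N ≈ₘ M
        N≉M N≈M = N∉Q (∈-resp-≈ₘ {M} {N} Q (λ j k → sym (N≈M j k)) M∈Q)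

      from-joined : ∀ z → ¬ z * z ≈ - det (defect N Q) → Joined N (proj₁ (Inverse.from difference z))
      from-joined z z²≉-det = det≉0⇒joined {N} {M} λ det≈0 → z²≉-det (trans
        (sym (*-cong (Inverse.strictlyInverseˡ difference z) (Inverse.strictlyInverseˡ difference z)))
        (≈-by-multiple (trans (sym (4detdet M M∈Q)) (x≈0⇒y*x≈0 _ (trans (*-congʳ det≈0) (zeroˡ _)))) 1#
          (solve 2 (λ d s → s :- :- d := con (+ 1) :* (d :+ s :- con (+ 0))) refl (det (defect N Q)) _)))
        where
        M = proj₁ (Inverse.from difference z)
        M∈Q = proj₂ (Inverse.from difference z)

    -- For the converse, the points of `Q` with coordinates 0 and 1 are distinct, and two distinct
    -- points determine the block.
    extensionality : ∀ Q R → Q ≈ᵦ R ⇔ (∀ N → N ∈ Q ⇔ N ∈ R)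
    extensionality Q R = mk⇔
      (λ Q≈R N → mk⇔ (∈-resp-≈ᵦ {N} {R} {Q} (Setoid.sym Blocks {Q} {R} Q≈R)) (∈-resp-≈ᵦ {N} {Q} {R} Q≈R))
      (λ Q⇔R → let N , N∈Q = point 0#; M , M∈Q = point 1# in
        common-block {N} {M} (λ N≈M → 1≉0 (sym (inverse-injective (↔-sym (points-of-block Q)) N≈M)))
          {Q} {R} N∈Q M∈Q (Equivalence.to (Q⇔R N) N∈Q) (Equivalence.to (Q⇔R M) M∈Q))
      where
      point = Inverse.from (points-of-block Q)

    identityQuadric : QuadricMatrix
    identityQuadric = record
      { B           = I 2
      ; C           = 0ₘ
      ; det≉0       = λ det≈0 → 1≉0 (trans
          (solve 0 (con (+ 1) := con (+ 1) :* con (+ 1) :- con (+ 0) :* con (+ 0)) refl) det≈0)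
      ; C-symmetric = λ _ _ → refl
      }

    -- Against `identityQuadric` the defect is N + Nᵀ = diag (1, - d). Its determinant is `- d`, and
    -- the entry 1 keeps the point off the block.
    pointWithDiscriminant : Carrier → Matrix 2 2
    pointWithDiscriminant d = (½ ∷ 0# ∷ []) ∷ (0# ∷ - (½ * d) ∷ []) ∷ []

    pointWithDiscriminant-∉ : ∀ d → ¬ pointWithDiscriminant d ∈ identityQuadric
    pointWithDiscriminant-∉ d P∈Q = 1≉0 (trans (sym (trans
      (solve 1 (λ h → h :* con (+ 1) :+ (con (+ 0) :* con (+ 0) :+ con (+ 0)) :+
                      (h :* con (+ 1) :+ (con (+ 0) :* con (+ 0) :+ con (+ 0))) :+ con (+ 0) :=
                      (con (+ 1) :+ con (+ 1)) :* h) refl ½) 2*½≈1)) (P∈Q 0F 0F))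

    discriminant-of-point : ∀ d → - det (defect (pointWithDiscriminant d) identityQuadric) ≈ d
    -- The difference of the two sides is d((2 · ½)² - 1), which factors as d(2 · ½ + 1)(2 · ½ - 1).
    discriminant-of-point d = ≈-by-multiple 2*½≈1 (d * ((1# + 1#) * ½ + 1#))
      (solve 2 (λ h d →
        let o = con (+ 0); e = con (+ 1)
            a = h :* e :+ (o :* o :+ o) :+ (h :* e :+ (o :* o :+ o)) :+ o
            b = h :* o :+ (o :* e :+ o) :+ (o :* e :+ (:- (h :* d) :* o :+ o)) :+ o
            b′ = (o :* e :+ (:- (h :* d) :* o :+ o)) :+ (h :* o :+ (o :* e :+ o)) :+ o
            c = o :* o :+ (:- (h :* d) :* e :+ o) :+ (o :* o :+ (:- (h :* d) :* e :+ o)) :+ o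
        in :- (a :* c :- b :* b′) :- d := d :* ((e :+ e) :* h :+ e) :* ((e :+ e) :* h :- e)) refl ½ d)

    attained-from : ∀ {n} d → Exactly n setoid (λ z → ¬ z * z ≈ d) → ∃₂ λ P Q → ¬ P ∈ Q × JoinedPointsOf Q P n
    attained-from d count =
      P , identityQuadric , pointWithDiscriminant-∉ d ,
      ↔-trans (joined-points P identityQuadric (pointWithDiscriminant-∉ d))
        (Exactly-resp-⇔ (λ z → mk⇔ (λ z²≉d z²≈ → z²≉d (trans z²≈ (discriminant-of-point d)))
                                   (λ z²≉ z²≈d → z²≉ (trans z²≈d (sym (discriminant-of-point d))))) count)
      where P = pointWithDiscriminant d

    attained : ∀ j → ∃₂ λ P Q → ¬ P ∈ Q × JoinedPointsOf Q P (Vec.lookup (q ∸ 2 Vec.∷ q ∸ 1 Vec.∷ q Vec.∷ Vec.[]) j)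
    attained 0F = attained-from 1# (square≉-square (*-identityˡ 1#) 1≉0)
    attained 1F = attained-from 0# (square≉0 refl)
    attained 2F = let x , ¬sq = nonSquare in attained-from x (square≉-nonSquare ¬sq)

    2≤q : 2 ℕ.≤ q
    2≤q = ≢⇒2≤ (λ eq → 1≉0 (inverse-injective size eq))

    size′ : HasSize setoid (q ∸ 1 ℕ.+ 1)
    size′ = ≡.subst (HasSize setoid) (≡.sym (ℕ.m∸n+n≡m (ℕ.≤-trans (ℕ.s≤s ℕ.z≤n) 2≤q))) size

    PGL₂-size′ : HasSize PGL₂ (q ℕ.* (q ℕ.^ 2 ∸ 1) ∸ 1 ℕ.+ 1)
    PGL₂-size′ = ≡.subst (HasSize PGL₂) (PGL₂-order 2≤q) PGL₂-size

    coordinateStructure-isGeneralizedPartialGeometry :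
      IsGeneralizedPartialGeometry coordinateStructure
        3 (q ∸ 1) (q ℕ.* (q ℕ.^ 2 ∸ 1) ∸ 1) (q ∸ 2 Vec.∷ q ∸ 1 Vec.∷ q Vec.∷ Vec.[])
    coordinateStructure-isGeneralizedPartialGeometry = record
      { ∈-resp-≈ₚ        = λ {N} {M} → ∈-resp-≈ₘ {N} {M}
      ; extensionality   = extensionality
      ; finite           = _ , Matrices₂-size
      ; non-empty        = 0ₘ
      ; common-block     = λ {N} {M} N≉M {Q} {R} → common-block {N} {M} N≉M {Q} {R}
      ; points-per-block = λ Q → ↔-trans (points-of-block Q) size′
      ; blocks-per-point = λ N → ↔-trans (blocks-per-point N) PGL₂-size′
      ; joined           = λ N Q N∉Q → let j , count = square≉-count (- det (defect N Q))
                                       in j , ↔-trans (joined-points N Q N∉Q) count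
      ; attained         = attained
      }

-- Coordinates of the lines skew to L₀

module Lines {c ℓ q} (F : FiniteField c ℓ q) where
  open FiniteField F
  open import Data.Vec.Functional using (Vector; _++_)
  open ProjectiveSpace F
  open MatrixProperties F
  open ProjectiveMatrices F
  open import Relation.Binary.Reasoning.Setoid setoid
  open IncidenceStructure 𝓛₁,𝓗₁ using (Points; Point; _≈ₚ_)

  private
    variable
      l m n : ℕ

  left right : Matrix m 4 → Matrix m 2
  left  L j k = L j (k Fin.↑ˡ 2)
  right L j k = L j (2 Fin.↑ʳ k)

  lineMatrix : Matrix 2 2 → Matrix 2 4
  lineMatrix N j = N j ++ I 2 j

  ∙-lineMatrix-left : ∀ (v : Vector Carrier 2) N k → (v ∙ lineMatrix N) (k Fin.↑ˡ 2) ≈ (v ∙ N) k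
  ∙-lineMatrix-left v N = entries₂ refl refl

  ∙-lineMatrix-right : ∀ (v : Vector Carrier 2) N k → (v ∙ lineMatrix N) (2 Fin.↑ʳ k) ≈ v k
  ∙-lineMatrix-right v N = entries₂ (∙-I v 0F) (∙-I v 1F)

  ∙-L₀-left : ∀ (v : Vector Carrier 2) k → (v ∙ L₀) (k Fin.↑ˡ 2) ≈ v k
  ∙-L₀-left v = entries₂ (∙-I v 0F) (∙-I v 1F)

  ∙-L₀-right : ∀ (v : Vector Carrier 2) k → (v ∙ L₀) (2 Fin.↑ʳ k) ≈ 0#
  ∙-L₀-right v = entries₂ (zeros 0F) (zeros 1F)
    where
    zeros : v ∙ 0ₘ {2} {2} ≋ 0ᵥ
    zeros = ∙-zeroʳ v (λ _ _ → refl)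

  ≋-halves : ∀ {u v : Vector Carrier 4} → (∀ (k : Fin 2) → u (k Fin.↑ˡ 2) ≈ v (k Fin.↑ˡ 2)) →
             (∀ (k : Fin 2) → u (2 Fin.↑ʳ k) ≈ v (2 Fin.↑ʳ k)) → u ≋ v
  ≋-halves left≈ right≈ = entries₄ (left≈ 0F) (left≈ 1F) (right≈ 0F) (right≈ 1F)

  row-∈Span : ∀ (A : Matrix m n) j → A j ∈Span A
  row-∈Span A j = I _ j , I-∙ j A

  ∈Span-resp-≋ : ∀ {u v} (A : Matrix m n) → u ≋ v → u ∈Span A → v ∈Span A
  ∈Span-resp-≋ A u≋v (w , wA≋u) = w , λ k → trans (wA≋u k) (u≋v k)

  module _ {L : Matrix l n} {M : Matrix m n} (M⊆L : ∀ j → M j ∈Span L) where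
    private
      X : Matrix m l
      X j = proj₁ (M⊆L j)

      M≈XL : M ≈ₘ X · L
      M≈XL j k = sym (proj₂ (M⊆L j) k)

    rows∈Span⇒Span⊆Span : ∀ v → v ∈Span M → v ∈Span L
    rows∈Span⇒Span⊆Span v (u , uM≋v) = u ∙ X , λ k → begin
      ((u ∙ X) ∙ L) k    ≈⟨ ∙-assoc u X L k ⟩
      (u ∙ (X · L)) k    ≈⟨ ∙-congˡ u M≈XL k ⟨
      (u ∙ M) k          ≈⟨ uM≋v k ⟩
      v k                ∎

    -- Since M = XL, the product M Q Mᵀ is X (L Q Lᵀ) Xᵀ. Containment in a quadric thus depends only
    -- on the row span.
    rows∈Span⇒isotropic : (Q : Matrix n n) → L · Q · L ᵀ ≈ₘ 0ₘ → M · Q · M ᵀ ≈ₘ 0ₘ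
    rows∈Span⇒isotropic Q LQLᵀ≈0 j k = begin
      ((M j ∙ Q) ∙ M ᵀ) k                   ≈⟨ ∙-congʳ (M ᵀ) (∙-congʳ Q (M≈XL j)) k ⟩
      (((X j ∙ L) ∙ Q) ∙ M ᵀ) k             ≈⟨ ∙-congˡ ((X j ∙ L) ∙ Q) {M ᵀ} {(X · L) ᵀ} (λ i j → M≈XL j i) k ⟩
      (((X j ∙ L) ∙ Q) ∙ (X · L) ᵀ) k       ≈⟨ ∙-congˡ ((X j ∙ L) ∙ Q) (·-ᵀ X L) k ⟩
      (((X j ∙ L) ∙ Q) ∙ (L ᵀ · X ᵀ)) k     ≈⟨ ∙-assoc ((X j ∙ L) ∙ Q) (L ᵀ) (X ᵀ) k ⟨
      ((((X j ∙ L) ∙ Q) ∙ L ᵀ) ∙ X ᵀ) k     ≈⟨ ∙-congʳ (X ᵀ) (∙-congʳ (L ᵀ) (∙-assoc (X j) L Q)) k ⟩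
      (((X j ∙ (L · Q)) ∙ L ᵀ) ∙ X ᵀ) k     ≈⟨ ∙-congʳ (X ᵀ) (∙-assoc (X j) (L · Q) (L ᵀ)) k ⟩
      ((X j ∙ (L · Q · L ᵀ)) ∙ X ᵀ) k       ≈⟨ ∙-zeroˡ (X ᵀ) (∙-zeroʳ (X j) LQLᵀ≈0) k ⟩
      0#                                    ∎

  lineMatrix-independentRows : ∀ N → IndependentRows (lineMatrix N)
  lineMatrix-independentRows N v vL≋0 k = trans (sym (∙-lineMatrix-right v N k)) (vL≋0 (2 Fin.↑ʳ k))

  -- The right half of a vector of the line is its own coefficient vector, while vectors of L₀ have
  -- right half zero.
  lineMatrix-skew : ∀ N → Skew (lineMatrix N) L₀
  lineMatrix-skew N v (u , uL≋v) (w , wL₀≋v) k = trans (sym (uL≋v k)) (∙-zeroˡ (lineMatrix N) u≋0 k)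
    where
    u≋0 : u ≋ 0ᵥ
    u≋0 k = begin
      u k                                  ≈⟨ ∙-lineMatrix-right u N k ⟨
      (u ∙ lineMatrix N) (2 Fin.↑ʳ k)      ≈⟨ uL≋v (2 Fin.↑ʳ k) ⟩
      v (2 Fin.↑ʳ k)                       ≈⟨ wL₀≋v (2 Fin.↑ʳ k) ⟨
      (w ∙ L₀) (2 Fin.↑ʳ k)                ≈⟨ ∙-L₀-right w k ⟩
      0#                                   ∎

  line : Matrix 2 2 → Point
  line N = record { matrix = lineMatrix N ; rank-2 = lineMatrix-independentRows N } , lineMatrix-skew N

  line-cong : ∀ {N M} → N ≈ₘ M → line N ≈ₚ line M
  line-cong {N} {M} N≈M v = mk⇔ (⊆ {N} {M} N≈M v) (⊆ {M} {N} (λ j k → sym (N≈M j k)) v)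
    where
    ⊆ : ∀ {N M} → N ≈ₘ M → ∀ v → v ∈Span lineMatrix N → v ∈Span lineMatrix M
    ⊆ {N} {M} N≈M = rows∈Span⇒Span⊆Span {L = lineMatrix M} {M = lineMatrix N} λ j →
      ∈Span-resp-≋ (lineMatrix M) (entries₄ (sym (N≈M j 0F)) (sym (N≈M j 1F)) refl refl) (row-∈Span (lineMatrix M) j)

  -- The identity in the right halves forces row `j` to be the combination with coefficients
  -- `I 2 j`, that is, row `j` of the other matrix.
  lineMatrix-injective : ∀ {N M} → (∀ j → lineMatrix N j ∈Span lineMatrix M) → N ≈ₘ M
  lineMatrix-injective {N} {M} N⊆M j k = begin
      N j k                                ≈⟨ left-lineMatrix j k ⟨
      lineMatrix N j (k Fin.↑ˡ 2)          ≈⟨ uM≋Nⱼ (k Fin.↑ˡ 2) ⟨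
      (u ∙ lineMatrix M) (k Fin.↑ˡ 2)      ≈⟨ ∙-lineMatrix-left u M k ⟩
      (u ∙ M) k                            ≈⟨ ∙-congʳ M u≋Iⱼ k ⟩
      (I 2 j ∙ M) k                        ≈⟨ I-∙ j M k ⟩
      M j k                                ∎
    where
    u : Vector Carrier 2
    u = proj₁ (N⊆M j)

    uM≋Nⱼ : u ∙ lineMatrix M ≋ lineMatrix N j
    uM≋Nⱼ = proj₂ (N⊆M j)

    left-lineMatrix : ∀ j k → lineMatrix N j (k Fin.↑ˡ 2) ≈ N j k
    left-lineMatrix j = entries₂ refl refl

    right-lineMatrix : ∀ j k → lineMatrix N j (2 Fin.↑ʳ k) ≈ I 2 j k
    right-lineMatrix j = entries₂ refl refl

    u≋Iⱼ : u ≋ I 2 j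
    u≋Iⱼ k = trans (sym (∙-lineMatrix-right u M k)) (trans (uM≋Nⱼ (2 Fin.↑ʳ k)) (right-lineMatrix j k))

  line-injective : ∀ {N M} → line N ≈ₚ line M → N ≈ₘ M
  line-injective {N} {M} N≈M = lineMatrix-injective {N} {M} λ j →
    Equivalence.to (N≈M (lineMatrix N j)) (row-∈Span (lineMatrix N) j)

  module Normalise (L : Matrix 2 4) (rank-2 : IndependentRows L) (skew : Skew L L₀) where

    -- A combination of the rows whose right half vanishes lies on L₀. Skewness makes it zero, and
    -- rank 2 then makes its coefficients zero.
    right-independentRows : IndependentRows (right L)
    right-independentRows u uD≋0 = rank-2 u (skew (u ∙ L) (u , λ _ → refl)
      (u ∙ left L , ≋-halves (∙-L₀-left (u ∙ left L)) λ k → trans (∙-L₀-right (u ∙ left L) k) (sym (uD≋0 k))))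

    right-det≉0 : ¬ det (right L) ≈ 0#
    right-det≉0 = independentRows⇒det≉0 {right L} right-independentRows

    right⁻¹ : Matrix 2 2
    right⁻¹ j = solution {right L} right-det≉0 (I 2 j)

    right⁻¹·right : right⁻¹ · right L ≈ₘ I 2
    right⁻¹·right j = solution-∙ {right L} right-det≉0 (I 2 j)

    right·right⁻¹ : right L · right⁻¹ ≈ₘ I 2
    right·right⁻¹ j = det≉0⇒∙-cancel {right L} right-det≉0 {right L j ∙ right⁻¹} {I 2 j} λ k → begin
      ((right L j ∙ right⁻¹) ∙ right L) k    ≈⟨ ∙-assoc (right L j) right⁻¹ (right L) k ⟩
      (right L j ∙ (right⁻¹ · right L)) k    ≈⟨ ∙-congˡ (right L j) right⁻¹·right k ⟩
      (right L j ∙ I 2) k                    ≈⟨ ∙-I (right L j) k ⟩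
      right L j k                            ≈⟨ I-∙ j (right L) k ⟨
      (I 2 j ∙ right L) k                    ∎

    coordinates : Matrix 2 2
    coordinates = right⁻¹ · left L

    rows-of-normalForm : ∀ j → lineMatrix coordinates j ∈Span L
    rows-of-normalForm j = right⁻¹ j , ≋-halves (entries₂ refl refl) (entries₂ (right⁻¹·right j 0F) (right⁻¹·right j 1F))

    rows-in-normalForm : ∀ j → L j ∈Span lineMatrix coordinates
    rows-in-normalForm j = right L j , ≋-halves
      (λ k → begin
        (right L j ∙ lineMatrix coordinates) (k Fin.↑ˡ 2)   ≈⟨ ∙-lineMatrix-left (right L j) coordinates k ⟩
        (right L j ∙ (right⁻¹ · left L)) k                  ≈⟨ ∙-assoc (right L j) right⁻¹ (left L) k ⟨
        ((right L j ∙ right⁻¹) ∙ left L) k                  ≈⟨ ∙-congʳ (left L) (right·right⁻¹ j) k ⟩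
        (I 2 j ∙ left L) k                                  ≈⟨ I-∙ j (left L) k ⟩
        left L j k                                          ∎)
      (∙-lineMatrix-right (right L j) coordinates)

  coordinates : Point → Matrix 2 2
  coordinates (L , skew) = Normalise.coordinates (matrix L) (rank-2 L) skew

  line-coordinates : ∀ L → line (coordinates L) ≈ₚ L
  line-coordinates (L , skew) v = mk⇔
    (rows∈Span⇒Span⊆Span {L = matrix L} {M = lineMatrix N.coordinates} N.rows-of-normalForm v)
    (rows∈Span⇒Span⊆Span {L = lineMatrix N.coordinates} {M = matrix L} N.rows-in-normalForm v)
    where module N = Normalise (matrix L) (rank-2 L) skew

  -- All obligations reduce to `line-coordinates` and `line-injective`, so the coordinates of two
  -- matrices of one line need no direct comparison.
  pointCoordinates : Inverse Points Matrices₂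
  pointCoordinates = injectiveSection⇒inverse
    coordinates
    (λ {L} {M} L≈M → line-injective {coordinates L} {coordinates M}
      (≈-trans {line (coordinates L)} {L} {line (coordinates M)} (line-coordinates L)
        (≈-trans {L} {M} {line (coordinates M)} L≈M (≈-sym {line (coordinates M)} {M} (line-coordinates M)))))
    (λ {L} {M} N≈M → ≈-trans {L} {line (coordinates L)} {M} (≈-sym {line (coordinates L)} {L} (line-coordinates L))
      (≈-trans {line (coordinates L)} {line (coordinates M)} {M}
        (line-cong {coordinates L} {coordinates M} N≈M) (line-coordinates M)))
    line
    (λ N → line-injective {coordinates (line N)} {N} (line-coordinates (line N)))
    where open Setoid Points using () renaming (trans to ≈-trans; sym to ≈-sym)

-- Coordinates of the hyperbolic quadrics through L₀

module Quadrics {c ℓ q} (F : FiniteField c ℓ q) where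
  open FiniteField F
  open import Data.Vec.Functional as Vector using (Vector; []; _∷_; _++_)
  open ProjectiveSpace F
  open FieldProperties F
  open MatrixProperties F
  open ProjectiveMatrices F
  open Coordinates F
  open QuadricMatrix
  open Lines F
  open IntegerCoefficientSolver commutativeRing
  open import Relation.Binary.Reasoning.Setoid setoid
  open IncidenceStructure 𝓛₁,𝓗₁ using (Blocks; Point; Block) renaming (_∈_ to _∈′_)

  gramMatrix : Matrix 2 2 → Matrix 2 2 → Matrix 4 4
  gramMatrix B C = (λ (j : Fin 2) → 0ᵥ {2} ++ B j) ++ (λ j → (B ᵀ) j ++ C j)

  -- These unfold exactly like the matrices that they evaluate to at concrete indices.
  private
    module Polynomials {v : ℕ} where
      𝔽 : Set
      𝔽 = Polynomial v

      infixl 7 _∙ₚ_ _·ₚ_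
      _∙ₚ_ : ∀ {m n} → Vector 𝔽 m → Vector (Vector 𝔽 n) m → Vector 𝔽 n
      (u ∙ₚ A) k = Vector.foldr _:+_ (con (+ 0)) (λ j → u j :* A j k)

      _·ₚ_ : ∀ {l m n} → Vector (Vector 𝔽 m) l → Vector (Vector 𝔽 n) m → Vector (Vector 𝔽 n) l
      (A ·ₚ B) j = A j ∙ₚ B

      Iₚ : ∀ n → Vector (Vector 𝔽 n) n
      Iₚ n j k = if does (j Fin.≟ k) then con (+ 1) else con (+ 0)

      gramMatrixₚ : Vector (Vector 𝔽 2) 2 → Vector (Vector 𝔽 2) 2 → Vector (Vector 𝔽 4) 4
      gramMatrixₚ B C = (λ (j : Fin 2) → (λ (_ : Fin 2) → con (+ 0)) ++ B j) ++ (λ j → (λ k → B k j) ++ C j)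

      hyperbolicFormₚ : Vector (Vector 𝔽 4) 4
      hyperbolicFormₚ = (o ∷ e ∷ o ∷ o ∷ []) ∷ (e ∷ o ∷ o ∷ o ∷ []) ∷ (o ∷ o ∷ o ∷ e ∷ []) ∷ (o ∷ o ∷ e ∷ o ∷ []) ∷ []
        where
        o = con (+ 0)
        e = con (+ 1)

      square : Fin v → Fin v → Fin v → Fin v → Vector (Vector 𝔽 2) 2
      square a b c d = (var a ∷ var b ∷ []) ∷ (var c ∷ var d ∷ []) ∷ []

    open Polynomials

  module _ (N B C : Matrix 2 2) where
    private
      ρ : Vec.Vec Carrier 12
      ρ = N 0F 0F Vec.∷ N 0F 1F Vec.∷ N 1F 0F Vec.∷ N 1F 1F Vec.∷
          B 0F 0F Vec.∷ B 0F 1F Vec.∷ B 1F 0F Vec.∷ B 1F 1F Vec.∷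
          C 0F 0F Vec.∷ C 0F 1F Vec.∷ C 1F 0F Vec.∷ C 1F 1F Vec.∷ Vec.[]

      Nₚ Bₚ Cₚ : Vector (Vector (Polynomial 12) 2) 2
      Nₚ = square (# 0) (# 1) (# 2) (# 3)
      Bₚ = square (# 4) (# 5) (# 6) (# 7)
      Cₚ = square (# 8) (# 9) (# 10) (# 11)

      Lₚ : Vector (Vector (Polynomial 12) 4) 2
      Lₚ j = Nₚ j ++ Iₚ 2 j

      lhs rhs : Fin 2 → Fin 2 → Polynomial 12
      lhs = Lₚ ·ₚ gramMatrixₚ Bₚ Cₚ ·ₚ (λ i k → Lₚ k i)
      rhs j k = (Nₚ ·ₚ Bₚ) j k :+ (Nₚ ·ₚ Bₚ) k j :+ Cₚ j k

    lineMatrix·gramMatrix : ∀ j k → (lineMatrix N · gramMatrix B C · lineMatrix N ᵀ) j k ≈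
                            symmetrization (N · B) j k + C j k
    lineMatrix·gramMatrix = entries₂
      (entries₂ (prove ρ (lhs 0F 0F) (rhs 0F 0F) refl) (prove ρ (lhs 0F 1F) (rhs 0F 1F) refl))
      (entries₂ (prove ρ (lhs 1F 0F) (rhs 1F 0F) refl) (prove ρ (lhs 1F 1F) (rhs 1F 1F) refl))

  ·-·ᵀ-cong : ∀ {m n} (A : Matrix m n) {G H : Matrix n n} → G ≈ₘ H → A · G · A ᵀ ≈ₘ A · H · A ᵀ
  ·-·ᵀ-cong A {G} {H} G≈H j = ∙-congʳ (A ᵀ) (∙-congˡ (A j) {G} {H} G≈H)

  L₀·G·L₀ᵀ : ∀ (G : Matrix 4 4) (j k : Fin 2) → (L₀ · G · L₀ ᵀ) j k ≈ G (j Fin.↑ˡ 2) (k Fin.↑ˡ 2)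
  L₀·G·L₀ᵀ G j k = trans (column k) (row j)
    where
    row : ∀ j → (L₀ j ∙ G) (k Fin.↑ˡ 2) ≈ G (j Fin.↑ˡ 2) (k Fin.↑ˡ 2)
    row = entries₂ (I-∙ 0F G (k Fin.↑ˡ 2)) (I-∙ 1F G (k Fin.↑ˡ 2))

    column : ∀ k → ((L₀ j ∙ G) ∙ L₀ ᵀ) k ≈ (L₀ j ∙ G) (k Fin.↑ˡ 2)
    column = entries₂ (∙-I (L₀ j ∙ G) 0F) (∙-I (L₀ j ∙ G) 1F)

  topRight bottomRight : Matrix 4 4 → Matrix 2 2
  topRight    G j k = G (j Fin.↑ˡ 2) (2 Fin.↑ʳ k)
  bottomRight G j k = G (2 Fin.↑ʳ j) (2 Fin.↑ʳ k)

  gramMatrix-cong : ∀ {B B′ C C′} → B ≈ₘ B′ → C ≈ₘ C′ → gramMatrix B C ≈ₘ gramMatrix B′ C′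
  gramMatrix-cong B≈ C≈ = entries₄
    (entries₄ refl refl (B≈ 0F 0F) (B≈ 0F 1F)) (entries₄ refl refl (B≈ 1F 0F) (B≈ 1F 1F))
    (entries₄ (B≈ 0F 0F) (B≈ 1F 0F) (C≈ 0F 0F) (C≈ 0F 1F)) (entries₄ (B≈ 0F 1F) (B≈ 1F 1F) (C≈ 1F 0F) (C≈ 1F 1F))

  gramMatrix-scale : ∀ {B B′ C C′ x} → (∀ j k → B j k ≈ x * B′ j k) → (∀ j k → C j k ≈ x * C′ j k) →
                     ∀ j k → gramMatrix B C j k ≈ x * gramMatrix B′ C′ j k
  gramMatrix-scale {x = x} B≈ C≈ = entries₄
    (entries₄ 0≈x0 0≈x0 (B≈ 0F 0F) (B≈ 0F 1F)) (entries₄ 0≈x0 0≈x0 (B≈ 1F 0F) (B≈ 1F 1F))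
    (entries₄ (B≈ 0F 0F) (B≈ 1F 0F) (C≈ 0F 0F) (C≈ 0F 1F)) (entries₄ (B≈ 0F 1F) (B≈ 1F 1F) (C≈ 1F 0F) (C≈ 1F 1F))
    where
    0≈x0 = sym (zeroʳ x)

  -- The product `L₀ · G · L₀ ᵀ` is the upper left 2 × 2 block of `G`, and symmetry determines the
  -- lower left one.
  gramMatrix-of : ∀ (G : Matrix 4 4) → G ᵀ ≈ₘ G → L₀ · G · L₀ ᵀ ≈ₘ 0ₘ → G ≈ₘ gramMatrix (topRight G) (bottomRight G)
  gramMatrix-of G symmetric contained = entries₄
    (entries₄ (totallyIsotropic 0F 0F) (totallyIsotropic 0F 1F) refl refl)
    (entries₄ (totallyIsotropic 1F 0F) (totallyIsotropic 1F 1F) refl refl)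
    (entries₄ (symmetric 0F 2F) (symmetric 1F 2F) refl refl) (entries₄ (symmetric 0F 3F) (symmetric 1F 3F) refl refl)
    where
    totallyIsotropic : ∀ (j k : Fin 2) → G (j Fin.↑ˡ 2) (k Fin.↑ˡ 2) ≈ 0#
    totallyIsotropic j k = trans (sym (L₀·G·L₀ᵀ G j k)) (contained j k)

  invertible⇒·-·ᵀ-independentRows : ∀ {n} {P H : Matrix n n} → Invertible P → Invertible H →
                                    IndependentRows (P · H · P ᵀ)
  invertible⇒·-·ᵀ-independentRows {P = P} {H} P⁻¹ H⁻¹ v vPHPᵀ≋0 =
    invertible⇒independentRows {A = P} P⁻¹ v
      (invertible⇒independentRows {A = H} H⁻¹ (v ∙ P)
        (invertible⇒independentRows {A = P ᵀ} (ᵀ-invertible {A = P} P⁻¹) ((v ∙ P) ∙ H) λ k → begin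
          (((v ∙ P) ∙ H) ∙ P ᵀ) k      ≈⟨ ∙-congʳ (P ᵀ) (∙-assoc v P H) k ⟩
          ((v ∙ (P · H)) ∙ P ᵀ) k      ≈⟨ ∙-assoc v (P · H) (P ᵀ) k ⟩
          (v ∙ (P · H · P ᵀ)) k        ≈⟨ vPHPᵀ≋0 k ⟩
          0#                           ∎))

  hyperbolicForm-involutive : hyperbolicForm · hyperbolicForm ≈ₘ I 4
  hyperbolicForm-involutive = entries₄
    (entries₄ (entry 0F 0F refl) (entry 0F 1F refl) (entry 0F 2F refl) (entry 0F 3F refl))
    (entries₄ (entry 1F 0F refl) (entry 1F 1F refl) (entry 1F 2F refl) (entry 1F 3F refl))
    (entries₄ (entry 2F 0F refl) (entry 2F 1F refl) (entry 2F 2F refl) (entry 2F 3F refl))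
    (entries₄ (entry 3F 0F refl) (entry 3F 1F refl) (entry 3F 2F refl) (entry 3F 3F refl))
    where
    entry : ∀ j k → _ → _
    entry j k = prove Vec.[] ((hyperbolicFormₚ ·ₚ hyperbolicFormₚ) j k) (Iₚ 4 j k)

  module _ (Q : HyperbolicQuadric) (contained : ContainedIn L₀ (gram Q)) where
    private
      G = gram Q

    gram-independentRows : IndependentRows G
    gram-independentRows v vG≋0 with P , P⁻¹ , x , x≉0 , G≈xR ← hyperbolic Q =
      invertible⇒·-·ᵀ-independentRows {P = P} {hyperbolicForm} P⁻¹
        (hyperbolicForm , hyperbolicForm-involutive , hyperbolicForm-involutive) v
        λ k → *≈0∧≉0⇒≈0 x≉0 (trans (sym (∙-scale v {G} {P · hyperbolicForm · P ᵀ} G≈xR k)) (vG≋0 k))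

    -- Because (u 0) G = (0 uB), a left kernel vector of B extends by zeros to one of `G`, which is
    -- nondegenerate as the quadric is hyperbolic.
    topRight-independentRows : IndependentRows (topRight G)
    topRight-independentRows u uB≋0 = entries₂ (u0≋0 0F) (u0≋0 1F)
      where
      G≈ : G ≈ₘ gramMatrix (topRight G) (bottomRight G)
      G≈ = gramMatrix-of G (symmetric Q) contained

      zeros : ∀ a b → u 0F * 0# + (u 1F * 0# + (0# * a + (0# * b + 0#))) ≈ 0#
      zeros a b = solve 4 (λ u v a b →
        u :* con (+ 0) :+ (v :* con (+ 0) :+ (con (+ 0) :* a :+ (con (+ 0) :* b :+ con (+ 0)))) := con (+ 0)) refl
        (u 0F) (u 1F) a b

      values : ∀ k a b → u 0F * topRight G 0F k + (u 1F * topRight G 1F k + (0# * a + (0# * b + 0#))) ≈ 0#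
      values k a b = trans (solve 4 (λ u v a b →
        u :+ (v :+ (con (+ 0) :* a :+ (con (+ 0) :* b :+ con (+ 0)))) := u :+ (v :+ con (+ 0))) refl
        (u 0F * topRight G 0F k) (u 1F * topRight G 1F k) a b) (uB≋0 k)

      u0≋0 : u ++ 0ᵥ {2} ≋ 0ᵥ
      u0≋0 = gram-independentRows (u ++ 0ᵥ) λ k → trans (∙-congˡ (u ++ 0ᵥ {2}) G≈ k)
        (entries₄ {P = λ k → ((u ++ 0ᵥ {2}) ∙ gramMatrix (topRight G) (bottomRight G)) k ≈ 0#}
          (zeros _ _) (zeros _ _) (values 0F _ _) (values 1F _ _) k)

    quadricCoordinates : QuadricMatrix
    quadricCoordinates = record
      { B           = topRight G
      ; C           = bottomRight G
      ; det≉0       = independentRows⇒det≉0 {topRight G} topRight-independentRows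
      ; C-symmetric = λ j k → symmetric Q (2 Fin.↑ʳ k) (2 Fin.↑ʳ j)
      }

  -- With hyperbolicForm pairing the coordinates 0, 1 and 2, 3, the rows of this matrix have Gram
  -- matrix (0 B; Bᵀ AB + (AB)ᵀ).
  frame : Matrix 2 2 → Matrix 2 2 → Matrix 4 4
  frame A B = (1# ∷ 0# ∷ 0# ∷ 0# ∷ [])
            ∷ (0# ∷ 0# ∷ 1# ∷ 0# ∷ [])
            ∷ (A 0F 0F ∷ B 0F 0F ∷ A 0F 1F ∷ B 1F 0F ∷ [])
            ∷ (A 1F 0F ∷ B 0F 1F ∷ A 1F 1F ∷ B 1F 1F ∷ []) ∷ []

  private
    frameₚ : ∀ {v} → Vector (Vector (Polynomial v) 2) 2 → Vector (Vector (Polynomial v) 2) 2 →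
             Vector (Vector (Polynomial v) 4) 4
    frameₚ A B = (e ∷ o ∷ o ∷ o ∷ [])
               ∷ (o ∷ o ∷ e ∷ o ∷ [])
               ∷ (A 0F 0F ∷ B 0F 0F ∷ A 0F 1F ∷ B 1F 0F ∷ [])
               ∷ (A 1F 0F ∷ B 0F 1F ∷ A 1F 1F ∷ B 1F 1F ∷ []) ∷ []
      where
      o = con (+ 0)
      e = con (+ 1)

  module _ (A B : Matrix 2 2) where
    private
      ρ : Vec.Vec Carrier 8
      ρ = A 0F 0F Vec.∷ A 0F 1F Vec.∷ A 1F 0F Vec.∷ A 1F 1F Vec.∷
          B 0F 0F Vec.∷ B 0F 1F Vec.∷ B 1F 0F Vec.∷ B 1F 1F Vec.∷ Vec.[]

      Aₚ Bₚ : Vector (Vector (Polynomial 8) 2) 2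
      Aₚ = square (# 0) (# 1) (# 2) (# 3)
      Bₚ = square (# 4) (# 5) (# 6) (# 7)

      lhs rhs : Fin 4 → Fin 4 → Polynomial 8
      lhs = frameₚ Aₚ Bₚ ·ₚ hyperbolicFormₚ ·ₚ (λ i k → frameₚ Aₚ Bₚ k i)
      rhs = gramMatrixₚ Bₚ (λ j k → (Aₚ ·ₚ Bₚ) j k :+ (Aₚ ·ₚ Bₚ) k j)

      entry : ∀ j k → _ → _
      entry j k = prove ρ (lhs j k) (rhs j k)

    frame-gram : frame A B · hyperbolicForm · frame A B ᵀ ≈ₘ gramMatrix B (symmetrization (A · B))
    frame-gram = entries₄
      (entries₄ (entry 0F 0F refl) (entry 0F 1F refl) (entry 0F 2F refl) (entry 0F 3F refl))
      (entries₄ (entry 1F 0F refl) (entry 1F 1F refl) (entry 1F 2F refl) (entry 1F 3F refl))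
      (entries₄ (entry 2F 0F refl) (entry 2F 1F refl) (entry 2F 2F refl) (entry 2F 3F refl))
      (entries₄ (entry 3F 0F refl) (entry 3F 1F refl) (entry 3F 2F refl) (entry 3F 3F refl))

  module _ (A B : Matrix 2 2) (det≉0 : ¬ det B ≈ 0#) where
    private
      i : Carrier
      i = recip (det B) det≉0

      E : Matrix 2 2
      E = (i * B 1F 1F ∷ i * - B 0F 1F ∷ []) ∷ (i * - B 1F 0F ∷ i * B 0F 0F ∷ []) ∷ []

      -- The matrix `E ᵀ · A`, where `E` is the inverse of `B`. Rows 2 and 3 of `frame` are A (e₀,
      -- e₂) + Bᵀ (e₁, e₃) in the standard basis, so e₁ and e₃ are recovered by subtracting the
      -- first term and applying Eᵀ.
      E·A : Fin 2 → Fin 2 → Carrier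
      E·A j k = E 0F j * A 0F k + E 1F j * A 1F k

      frame⁻¹ : Matrix 4 4
      frame⁻¹ = (1# ∷ 0# ∷ 0# ∷ 0# ∷ [])
              ∷ (- E·A 0F 0F ∷ - E·A 0F 1F ∷ E 0F 0F ∷ E 1F 0F ∷ [])
              ∷ (0# ∷ 1# ∷ 0# ∷ 0# ∷ [])
              ∷ (- E·A 1F 0F ∷ - E·A 1F 1F ∷ E 0F 1F ∷ E 1F 1F ∷ []) ∷ []

      ρ : Vec.Vec Carrier 9
      ρ = A 0F 0F Vec.∷ A 0F 1F Vec.∷ A 1F 0F Vec.∷ A 1F 1F Vec.∷
          B 0F 0F Vec.∷ B 0F 1F Vec.∷ B 1F 0F Vec.∷ B 1F 1F Vec.∷ i Vec.∷ Vec.[]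

      Aₚ Bₚ Eₚ : Vector (Vector (Polynomial 9) 2) 2
      Aₚ = square (# 0) (# 1) (# 2) (# 3)
      Bₚ = square (# 4) (# 5) (# 6) (# 7)
      Eₚ = (iₚ :* Bₚ 1F 1F ∷ iₚ :* :- Bₚ 0F 1F ∷ []) ∷ (iₚ :* :- Bₚ 1F 0F ∷ iₚ :* Bₚ 0F 0F ∷ []) ∷ []
        where iₚ = var (# 8)

      o e excess : Polynomial 9
      o = con (+ 0)
      e = con (+ 1)
      excess = (Bₚ 0F 0F :* Bₚ 1F 1F :- Bₚ 0F 1F :* Bₚ 1F 0F) :* var (# 8) :- e

      E·Aₚ : Fin 2 → Fin 2 → Polynomial 9
      E·Aₚ j k = Eₚ 0F j :* Aₚ 0F k :+ Eₚ 1F j :* Aₚ 1F k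

      frame⁻¹ₚ : Vector (Vector (Polynomial 9) 4) 4
      frame⁻¹ₚ = (e ∷ o ∷ o ∷ o ∷ [])
               ∷ (:- E·Aₚ 0F 0F ∷ :- E·Aₚ 0F 1F ∷ Eₚ 0F 0F ∷ Eₚ 1F 0F ∷ [])
               ∷ (o ∷ e ∷ o ∷ o ∷ [])
               ∷ (:- E·Aₚ 1F 0F ∷ :- E·Aₚ 1F 1F ∷ Eₚ 0F 1F ∷ Eₚ 1F 1F ∷ []) ∷ []

      -- The products differ from the identity by these multiples of det B · i - 1.
      coefficient coefficient′ : Vector (Vector (Polynomial 9) 4) 4
      coefficient = (o ∷ o ∷ o ∷ o ∷ [])
                  ∷ (o ∷ o ∷ o ∷ o ∷ [])
                  ∷ (:- Aₚ 0F 0F ∷ :- Aₚ 0F 1F ∷ e ∷ o ∷ [])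
                  ∷ (:- Aₚ 1F 0F ∷ :- Aₚ 1F 1F ∷ o ∷ e ∷ []) ∷ []
      coefficient′ = (o ∷ o ∷ o ∷ o ∷ [])
                   ∷ (o ∷ e ∷ o ∷ o ∷ [])
                   ∷ (o ∷ o ∷ o ∷ o ∷ [])
                   ∷ (o ∷ o ∷ o ∷ e ∷ []) ∷ []

      entry : ∀ j k → _ → _
      entry j k hyp = ≈-by-multiple (recip-inverseʳ (det B) det≉0) _
        (prove ρ ((frameₚ Aₚ Bₚ ·ₚ frame⁻¹ₚ) j k :- Iₚ 4 j k) (coefficient j k :* excess) hyp)

      entry′ : ∀ j k → _ → _
      entry′ j k hyp = ≈-by-multiple (recip-inverseʳ (det B) det≉0) _
        (prove ρ ((frame⁻¹ₚ ·ₚ frameₚ Aₚ Bₚ) j k :- Iₚ 4 j k) (coefficient′ j k :* excess) hyp)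

    frame-invertible : Invertible (frame A B)
    frame-invertible = frame⁻¹ ,
      entries₄
        (entries₄ (entry 0F 0F refl) (entry 0F 1F refl) (entry 0F 2F refl) (entry 0F 3F refl))
        (entries₄ (entry 1F 0F refl) (entry 1F 1F refl) (entry 1F 2F refl) (entry 1F 3F refl))
        (entries₄ (entry 2F 0F refl) (entry 2F 1F refl) (entry 2F 2F refl) (entry 2F 3F refl))
        (entries₄ (entry 3F 0F refl) (entry 3F 1F refl) (entry 3F 2F refl) (entry 3F 3F refl)) ,
      entries₄
        (entries₄ (entry′ 0F 0F refl) (entry′ 0F 1F refl) (entry′ 0F 2F refl) (entry′ 0F 3F refl))
        (entries₄ (entry′ 1F 0F refl) (entry′ 1F 1F refl) (entry′ 1F 2F refl) (entry′ 1F 3F refl))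
        (entries₄ (entry′ 2F 0F refl) (entry′ 2F 1F refl) (entry′ 2F 2F refl) (entry′ 2F 3F refl))
        (entries₄ (entry′ 3F 0F refl) (entry′ 3F 1F refl) (entry′ 3F 2F refl) (entry′ 3F 3F refl))

  module _ (2≉0 : ¬ 1# + 1# ≈ 0#) where
    open OddCharacteristic 2≉0

    module _ (Q : QuadricMatrix) where
      private
        -- This is ½ C B⁻¹. Then AB = ½ C is symmetric, and the Gram matrix of `frame A (B Q)` is
        -- exactly (0 B; Bᵀ C).
        A : Matrix 2 2
        A j = solution {B Q} (det≉0 Q) (λ k → ½ * C Q j k)

        symmetrization≈C : symmetrization (A · B Q) ≈ₘ C Q
        symmetrization≈C j k = trans
          (+-cong (solution-∙ {B Q} (det≉0 Q) (λ k → ½ * C Q j k) k)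
                  (trans (solution-∙ {B Q} (det≉0 Q) (λ j → ½ * C Q k j) j) (*-congˡ (C-symmetric Q k j))))
          (≈-by-multiple 2*½≈1 (C Q j k)
            (solve 2 (λ h c → h :* c :+ h :* c :- c := c :* ((con (+ 1) :+ con (+ 1)) :* h :- con (+ 1)))
              refl ½ (C Q j k)))

      quadric : Block
      quadric = record
        { gram       = gramMatrix (B Q) (C Q)
        ; symmetric  = entries₄
            (entries₄ refl refl refl refl) (entries₄ refl refl refl refl)
            (entries₄ refl refl refl (C-symmetric Q 1F 0F)) (entries₄ refl refl (C-symmetric Q 0F 1F) refl)
        ; hyperbolic = frame A (B Q) , frame-invertible A (B Q) (det≉0 Q) , ≈ₘ⇒∝ λ j k →
            sym (trans (frame-gram A (B Q) j k)
                       (gramMatrix-cong {B Q} {B Q} {symmetrization (A · B Q)} {C Q} (λ _ _ → refl) symmetrization≈C j k))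
        } , λ j k → trans (L₀·G·L₀ᵀ (gramMatrix (B Q) (C Q)) j k)
              (entries₂ {P = λ j → ∀ k → gramMatrix (B Q) (C Q) (j Fin.↑ˡ 2) (k Fin.↑ˡ 2) ≈ 0#}
                (entries₂ refl refl) (entries₂ refl refl) j k)

    blockCoordinates : Inverse Blocks QuadricMatrices
    blockCoordinates = injectiveSection⇒inverse
      (λ (Q , contained) → quadricCoordinates Q contained)
      (λ {(Q , Q⊇L₀)} {(R , R⊇L₀)} (x , x≉0 , Q≈xR) →
        ∝-blocks {quadricCoordinates Q Q⊇L₀} {quadricCoordinates R R⊇L₀} x≉0 (λ j k → Q≈xR _ _) (λ j k → Q≈xR _ _))
      (λ {(Q , Q⊇L₀)} {(R , R⊇L₀)} Q≈R → injective Q Q⊇L₀ R R⊇L₀ Q≈R)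
      quadric
      (λ Q → ≈ₘ⇒∝ (entries₄ (entries₂ refl refl) (entries₂ refl refl) (entries₂ refl refl) (entries₂ refl refl)))
      where
      injective : ∀ Q (Q⊇L₀ : ContainedIn L₀ (gram Q)) R (R⊇L₀ : ContainedIn L₀ (gram R)) →
                  blocks (quadricCoordinates Q Q⊇L₀) ∝ blocks (quadricCoordinates R R⊇L₀) → gram Q ∝ gram R
      injective Q Q⊇L₀ R R⊇L₀ Q≈R@(x , x≉0 , _) = x , x≉0 , λ j k → begin
        gram Q j k                             ≈⟨ gramMatrix-of (gram Q) (symmetric Q) Q⊇L₀ j k ⟩
        gramMatrix (B Q′) (C Q′) j k           ≈⟨ gramMatrix-scale {B Q′} {B R′} {C Q′} {C R′}
                                                     (∝-B {Q′} {R′} Q≈R) (∝-C {Q′} {R′} Q≈R) j k ⟩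
        x * gramMatrix (B R′) (C R′) j k       ≈⟨ *-congˡ (gramMatrix-of (gram R) (symmetric R) R⊇L₀ j k) ⟨
        x * gram R j k                         ∎
        where
        Q′ = quadricCoordinates Q Q⊇L₀
        R′ = quadricCoordinates R R⊇L₀

    -- The matrix of `L` and its normal form have the same row span, so containment passes both ways
    -- between them; for the normal form it is the vanishing of `defect`.
    ∈⇔∈ : ∀ (L : Point) (Q : Block) → L ∈′ Q ⇔ Inverse.to pointCoordinates L ∈ Inverse.to blockCoordinates Q
    ∈⇔∈ (L , L∩L₀≡∅) (Q , Q⊇L₀) = mk⇔
      (λ L⊆Q j k → trans (sym (defect≈ j k))
        (rows∈Span⇒isotropic {L = matrix L} {M = lineMatrix N} N.rows-of-normalForm (gram Q) L⊆Q j k))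
      (λ N∈Q → rows∈Span⇒isotropic {L = lineMatrix N} {M = matrix L} N.rows-in-normalForm (gram Q)
        (λ j k → trans (defect≈ j k) (N∈Q j k)))
      where
      module N = Normalise (matrix L) (rank-2 L) L∩L₀≡∅

      N : Matrix 2 2
      N = N.coordinates

      Q′ : QuadricMatrix
      Q′ = quadricCoordinates Q Q⊇L₀

      defect≈ : ∀ j k → (lineMatrix N · gram Q · lineMatrix N ᵀ) j k ≈ defect N Q′ j k
      defect≈ j k = trans
        (·-·ᵀ-cong (lineMatrix N) {gram Q} {gramMatrix (B Q′) (C Q′)} (gramMatrix-of (gram Q) (symmetric Q) Q⊇L₀) j k)
        (lineMatrix·gramMatrix N (B Q′) (C Q′) j k)

open import Data.Nat using (ℕ; _+_; _*_; _∸_; _^_)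
open import Data.Vec using (Vec; []; _∷_)

theorem3p14 : ∀ {c ℓ : Level} (q : ℕ) → IsPrimePower q → ¬ 2 ∣ q →
    (F : FiniteField c ℓ q) →
    IsGeneralizedPartialGeometry (ProjectiveSpace.𝓛₁,𝓗₁ F)
    3 (q ∸ 1) (q * (q ^ 2 ∸ 1) ∸ 1) (q ∸ 2 ∷ q ∸ 1 ∷ q ∷ [])
theorem3p14 q _ 2∤q F = isomorphic⇒isGeneralizedPartialGeometry
  pointCoordinates (blockCoordinates 2≉0) (∈⇔∈ 2≉0) (coordinateStructure-isGeneralizedPartialGeometry 2≉0)
  where
  open FieldProperties F using (odd⇒2≉0)
  open Coordinates F using (coordinateStructure-isGeneralizedPartialGeometry)
  open Lines F using (pointCoordinates)
  open Quadrics F using (blockCoordinates; ∈⇔∈)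
  2≉0 = odd⇒2≉0 2∤q
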